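{- Let $m \geq 0$, $n \geq 1$ be integers. For a sorted configuration $c = (c^t; c^b)$ on $K_{m,n}^0$, let $k = (k_1,\ldots,k_n)$ with $k_j := |\{ i \in \{1,\ldots,m\} : c^t_i < j\}|$, and define $\Psi(c) := \big(F(k), F(c^b)\big)$. Then $\Psi$ is a bijection from the set of sorted stochastically recurrent configurations on $K_{m,n}^0$ to the set of compatible pairs $(F, F')$ with $F \in \mathrm{Ferrers}_{m,n}$ and $F' \in \mathrm{Ferrers}_{\leq m, n}$. Moreover, for such $c$, $\mathrm{level}(c) = \mathrm{Area}(F(c^b)) - \mathrm{Area}(F(k))$, and this is also the number of $\mathsf{Add}$ operations in any sequence of legal $\mathsf{Shift}$ and $\mathsf{Add}$ operations transforming $F(k)$ into $F(c^b)$.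
   Context: $K_{m,n}^0$ is the complete bipartite graph with "top" vertices $v^t_0, v^t_1, \ldots, v^t_m$ and "bottom" vertices $v^b_1, \ldots, v^b_n$, with an edge between every top vertex and every bottom vertex; $v^t_0$ is the sink. A configuration is a vector $c = (c^t_1, \ldots, c^t_m; c^b_1, \ldots, c^b_n)$ of non-negative integers ($c^*_i$ = number of grains at $v^*_i$); it is sorted if $c^t$ and $c^b$ are both weakly increasing. $c$ is stable if $c^t_i < n$ for all $i$ and $c^b_j < m+1$ for all $j$. Stochastic sandpile model (SSM) with a fixed parameter $p \in (0,1)$: an unstable vertex topples as follows: for each of its neighbours (for a bottom vertex this includes the sink), independently (and independently of all previous topplings), with probability $p$ it sends one grain to that neighbour, and otherwise keeps it; grains sent to the sink disappear. Repeated toppling from any configuration reaches a random stable configuration whose law does not depend on toppling order. In the Markov chain on stable configurations which at each step adds a grain to a uniformly random non-sink vertex and stabilises by the SSM, a stable configuration is stochastically recurrent if it is a recurrent state (appears infinitely often). The level is $\mathrm{level}(c) := \sum_i c^t_i + \sum_j c^b_j - mn$. A Ferrers diagram with $n$ rows is a left-aligned collection of cells in $n$ rows (ordered bottom to top, rows may be empty) whose row lengths are weakly increasing from bottom to top; for a weakly increasing $s = (s_1,\ldots,s_n)$ of non-negative integers, $F(s)$ is the Ferrers diagram with $s_i$ cells in row $i$. Its number of columns is $s_n$. $\mathrm{Ferrers}_{m,n}$ (resp. $\mathrm{Ferrers}_{\leq m,n}$) is the set of Ferrers diagrams with $n$ rows and exactly $m$ (resp. at most $m$) columns. $\mathrm{Area}(F)$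 is the number of cells. Operations on $F(s)$: $\mathsf{Shift}$ moves one cell from a row $p$ to a row $p' < p$ (i.e. $s_p \mapsto s_p - 1$, $s_{p'} \mapsto s_{p'} + 1$); $\mathsf{Add}$ adds a cell at the right of a row $p$ ($s_p \mapsto s_p + 1$). An operation is legal if the result is again a Ferrers diagram (the number of columns may change). An ordered pair $(F, F')$ is compatible if $F'$ can be obtained from $F$ by a finite sequence of legal $\mathsf{Shift}$ and $\mathsf{Add}$ operations. -}

module Defs where

open import Algebra.Bundles using (CommutativeRing)
import Algebra.Properties.CommutativeMonoid.Sum as Sums
import Algebra.Properties.Semiring.Mult as Mult
open import Data.Bool.Base using (true; false; if_then_else_)
open import Data.Empty using (⊥-elim)
open import Data.Fin.Base as Fin using (Fin; toℕ)
open import Data.Fin.Subset using (Subset; ∣_∣; inside; outside)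
open import Data.Integer.Base as ℤ using (ℤ; +_)
open import Data.Nat.Base as ℕ using (ℕ; zero; suc; _≤_; _<_; _∸_; z≤n; s≤s)
open import Data.Nat.Properties using (_≟_; _<?_; <⇒<ᵇ; <ᵇ⇒<; m≤n⇒m≤1+n; m<n⇒m<1+n)
open import Data.Product.Base using (Σ; ∃; ∃₂; _×_; _,_)
import Data.Product.Properties as Product
open import Data.Sum.Base using (_⊎_; inj₁; inj₂)
open import Data.Unit.Base using (tt)
open import Data.Vec.Base as Vec
  using (Vec; []; _∷_; lookup; tabulate; last; tail; count; zipWith; _[_]%=_)
import Data.Vec.Properties as Vec
open import Data.Vec.Relation.Unary.Linked using (Linked; []; [-]; _∷_)
open import Level using (Level; _⊔_) renaming (suc to lsuc)
open import Relation.Binary.Construct.Closure.ReflexiveTransitive using (Star; ε; _◅_)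
open import Relation.Binary.Core using (Rel)
open import Relation.Binary.Definitions using (DecidableEquality)
open import Relation.Binary.PropositionalEquality.Core using (_≡_)
open import Relation.Binary.Structures using (IsStrictTotalOrder)
open import Relation.Nullary.Decidable.Core using (does)
open import Relation.Nullary.Negation.Core using (¬_)

------------------------------------------------------------------------
-- The numbers in which probabilities live

-- The library has no real numbers. Classically, the Archimedean ordered
-- fields are exactly the subfields of ℝ, so that quantifying over such a field
-- and over p in it with 0 < p < 1 is quantifying over all real p ∈ (0,1).

record ArchimedeanOrderedField (a ℓ₁ ℓ₂ : Level) : Set (lsuc (a ⊔ ℓ₁ ⊔ ℓ₂)) where
  field
    commutativeRing : CommutativeRing a ℓ₁

  open CommutativeRing commutativeRing public
  open Mult semiring public using () renaming (_×_ to _·_)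

  infix 4 _<ᴷ_
  field
    _<ᴷ_               : Rel Carrier ℓ₂
    isStrictTotalOrder : IsStrictTotalOrder _≈_ _<ᴷ_
    0<1                : 0# <ᴷ 1#
    +-monoˡ-<          : ∀ {x y} z → x <ᴷ y → x + z <ᴷ y + z
    *-pos              : ∀ {x y} → 0# <ᴷ x → 0# <ᴷ y → 0# <ᴷ x * y
    -- total, with an unspecified value at zero
    _⁻¹                : Carrier → Carrier
    *-inverseʳ         : ∀ x → ¬ (x ≈ 0#) → x * x ⁻¹ ≈ 1#
    archimedean        : ∀ x → ∃ λ k → x <ᴷ k · 1#

------------------------------------------------------------------------
-- Configurations

Increasing : ∀ {n} → Vec ℕ n → Set
Increasing = Linked _≤_

-- (cᵗ , cᵇ); the sink carries no grains and is left out.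
Config : ℕ → ℕ → Set
Config m n = Vec ℕ m × Vec ℕ n

_≟ᶜ_ : ∀ {m n} → DecidableEquality (Config m n)
_≟ᶜ_ = Product.≡-dec (Vec.≡-dec _≟_) (Vec.≡-dec _≟_)

Sorted : ∀ {m n} → Config m n → Set
Sorted (t , b) = Increasing t × Increasing b

-- Proofs of Sorted c are unique, so _≡_ here is equality of configurations.
SortedConfig : ℕ → ℕ → Set
SortedConfig m n = Σ (Config m n) Sorted

-- The non-sink vertices.
data Vertex (m n : ℕ) : Set where
  top    : Fin m → Vertex m n
  bottom : Fin n → Vertex m n

-- The number of neighbours in the graph, the sink included.
degree : ∀ {m n} → Vertex m n → ℕ
degree {n = n} (top _)    = n
degree {m = m} (bottom _) = suc m

grains : ∀ {m n} → Config m n → Vertex m n → ℕ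
grains (t , b) (top i)    = lookup t i
grains (t , b) (bottom j) = lookup b j

Unstable : ∀ {m n} → Config m n → Vertex m n → Set
Unstable c v = degree v ≤ grains c v

Stable : ∀ {m n} → Config m n → Set
Stable c = ∀ v → grains c v < degree v

level : ∀ {m n} → Config m n → ℤ
level {m} {n} (t , b) = + (Vec.sum t ℕ.+ Vec.sum b) ℤ.- + (m ℕ.* n)

------------------------------------------------------------------------
-- Grain additions and topplings

addGrain : ∀ {m n} → Vertex m n → Config m n → Config m n
addGrain (top i)    (t , b) = t [ i ]%= suc , b
addGrain (bottom j) (t , b) = t , b [ j ]%= suc

receive : ∀ {k} → Subset k → Vec ℕ k → Vec ℕ k
receive = zipWith (λ s x → if s then suc x else x)

-- The subset is the set of neighbours which are sent a grain; for a bottom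
-- vertex its first element stands for the sink. Only unstable vertices are
-- ever toppled, so _∸_ does not truncate.
topple : ∀ {m n} (v : Vertex m n) → Subset (degree v) → Config m n → Config m n
topple (top i)    S (t , b) = t [ i ]%= (_∸ ∣ S ∣) , receive S b
topple (bottom j) S (t , b) = receive (tail S) t , b [ j ]%= (_∸ ∣ S ∣)

-- A choice of the vertex to topple next. The law of the stabilisation does not
-- depend on it.
record TopplingRule (m n : ℕ) : Set where
  field
    next : (c : Config m n) → Stable c ⊎ ∃ (Unstable c)

------------------------------------------------------------------------
-- The Markov chain

module Chain {a ℓ₁ ℓ₂} (K : ArchimedeanOrderedField a ℓ₁ ℓ₂)
             (p : ArchimedeanOrderedField.Carrier K)
             {m n : ℕ} (rule : TopplingRule m n) where

  open ArchimedeanOrderedField K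
  open Sums +-commutativeMonoid using (sum)
  open TopplingRule rule

  -- Expectation over a random subset which contains each element independently
  -- with probability p.
  𝔼-subset : ∀ k → (Subset k → Carrier) → Carrier
  𝔼-subset zero    f = f []
  𝔼-subset (suc k) f = p * 𝔼-subset k (λ S → f (inside ∷ S))
                     + (1# - p) * 𝔼-subset k (λ S → f (outside ∷ S))

  -- Expectation over a uniformly random non-sink vertex.
  𝔼-vertex : (Vertex m n → Carrier) → Carrier
  𝔼-vertex f = ((m ℕ.+ n) · 1#) ⁻¹ * (sum (λ i → f (top i)) + sum (λ j → f (bottom j)))

  -- The chain is run one elementary step at a time: a grain is added to a
  -- stable configuration, and an unstable one undergoes one toppling. The
  -- stable configurations met along the way are, in order, the successive
  -- states of the Markov chain on stable configurations.
  𝔼-step : Config m n → (Config m n → Carrier) → Carrier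
  𝔼-step c f with next c
  ... | inj₁ _       = 𝔼-vertex (λ v → f (addGrain v c))
  ... | inj₂ (v , _) = 𝔼-subset (degree v) (λ S → f (topple v S c))

  -- ℙ-visits c N T x is the probability that, starting from x, at least N of
  -- the first T configurations (x included) are equal to c.
  ℙ-visits : Config m n → ℕ → ℕ → Config m n → Carrier
  ℙ-visits c zero    _       x = 1#
  ℙ-visits c (suc N) zero    x = 0#
  ℙ-visits c (suc N) (suc T) x =
    𝔼-step x (ℙ-visits c (if does (x ≟ᶜ c) then N else suc N) T)

  -- Started from c, the chain visits c infinitely often almost surely: for
  -- each N, the probability of at least N visits by time T tends to 1 with T.
  InfinitelyOften : Config m n → Set (a ⊔ ℓ₂)
  InfinitelyOften c =
    ∀ N ε → 0# <ᴷ ε → ∃ λ T → 1# - ε <ᴷ ℙ-visits c N T c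

  StochasticallyRecurrent : Config m n → Set (a ⊔ ℓ₂)
  StochasticallyRecurrent c = Stable c × InfinitelyOften c

open Chain public using (StochasticallyRecurrent)

------------------------------------------------------------------------
-- Ferrers diagrams

-- A diagram is its vector of row lengths, bottom row first. Proofs of
-- Increasing are unique, so _≡_ is equality of diagrams.
record Ferrers (n : ℕ) : Set where
  constructor ferrers
  field
    rows       : Vec ℕ n
    increasing : Increasing rows

open Ferrers public

columns : ∀ {n} → Ferrers n → ℕ
columns {zero}  _ = 0
columns {suc _} F = last (rows F)

area : ∀ {n} → Ferrers n → ℕ
area F = Vec.sum (rows F)

-- Legality of the operations is built into the type of their result.

Shift : ∀ {n} → Ferrers n → Ferrers n → Set
Shift F G = ∃₂ λ p p′ → p′ Fin.< p × 1 ≤ lookup (rows F) p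
                       × rows G ≡ (rows F [ p ]%= ℕ.pred) [ p′ ]%= suc

Add : ∀ {n} → Ferrers n → Ferrers n → Set
Add F G = ∃ λ p → rows G ≡ rows F [ p ]%= suc

data Operation {n} (F G : Ferrers n) : Set where
  shift : Shift F G → Operation F G
  add   : Add F G → Operation F G

Operations : ∀ {n} → Ferrers n → Ferrers n → Set
Operations = Star Operation

Compatible : ∀ {n} → Ferrers n → Ferrers n → Set
Compatible F F′ = Operations F F′

#adds : ∀ {n} {F G : Ferrers n} → Operations F G → ℕ
#adds ε             = 0
#adds (shift _ ◅ w) = #adds w
#adds (add _   ◅ w) = suc (#adds w)

-- The compatible pairs in Ferrers_{m,n} × Ferrers_{≤m,n}.
CompatiblePair : ∀ (m : ℕ) {n} → Ferrers n × Ferrers n → Set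
CompatiblePair m (F , F′) = columns F ≡ m × columns F′ ≤ m × Compatible F F′

------------------------------------------------------------------------
-- The map Ψ

#below : ∀ {m} → Vec ℕ m → ℕ → ℕ
#below t x = count (_<? x) t

#below-suc : ∀ {m} (t : Vec ℕ m) x → #below t x ≤ #below t (suc x)
#below-suc []      x = z≤n
#below-suc (y ∷ t) x
  with y ℕ.<ᵇ x | y ℕ.<ᵇ suc x | (λ y<x → <⇒<ᵇ (m<n⇒m<1+n (<ᵇ⇒< y x y<x)))
... | true  | true  | _   = s≤s (#below-suc t x)
... | true  | false | abs = ⊥-elim (abs tt)
... | false | true  | _   = m≤n⇒m≤1+n (#below-suc t x)
... | false | false | _   = #below-suc t x

-- Fin n is numbered from 0, hence the row index j of the mathematics is
-- suc (toℕ j) here.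
k-vector : ∀ {m n} → Vec ℕ m → Vec ℕ n
k-vector t = tabulate (λ j → #below t (suc (toℕ j)))

tabulate-increasing : ∀ {n} (f : ℕ → ℕ) → (∀ x → f x ≤ f (suc x)) →
                      Increasing (tabulate {n = n} (λ j → f (toℕ j)))
tabulate-increasing {zero}        f f↑ = []
tabulate-increasing {suc zero}    f f↑ = [-]
tabulate-increasing {suc (suc n)} f f↑ =
  f↑ 0 ∷ tabulate-increasing (λ x → f (suc x)) (λ x → f↑ (suc x))

k-vector-increasing : ∀ {m n} (t : Vec ℕ m) → Increasing (k-vector {n = n} t)
k-vector-increasing t =
  tabulate-increasing (λ x → #below t (suc x)) (λ x → #below-suc t (suc x))

Ψ : ∀ {m n} → SortedConfig m n → Ferrers n × Ferrers n
Ψ ((t , b) , _ , b↑) = ferrers (k-vector t) (k-vector-increasing t) , ferrers b b↑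

{-# OPTIONS --safe #-}
module Submission where

-- Call a configuration supported if the edges between non-sink vertices can be
-- oriented so that every vertex has at least as many grains as incoming edges.
-- Additions and topplings preserve this (orient the edges at the toppled vertex
-- along the grains which it sends), and from a stable configuration a supported
-- one is reached by filling the bottom vertices; hence recurrent configurations
-- are supported. Conversely, let O support the stable configuration c. From any
-- configuration one can reach the one with empty tops and m grains on each
-- bottom vertex; adding a grain to each bottom vertex in turn and toppling it
-- along its edges that leave it in O, and into the sink, yields a configuration
-- below c, and additions lead to c. So c is reached from every configuration in
-- a bounded number of steps with a probability bounded below, hence visited
-- infinitely often.
--
-- Counting edges into the first rows shows that, for a supported (t , b), the
-- partial sums of b are at least those of the vector k of t. Then k is turned
-- into b by operations: at the first entry where they differ, raise the end of
-- the block of equal entries, and take the cell from the first later entry which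
-- is larger by two or more, if there is one. Conversely k itself is supported
-- with t, and operations preserve this. Finally t ↦ k is conjugation of
-- diagrams, an involution.

open import Defs
import Algebra.Properties.CommutativeMonoid.Sum as Sums
import Algebra.Properties.Semiring.Mult as MultProperties
import Algebra.Solver.Ring.NaturalCoefficients.Default as SemiringSolver
open import Data.Bool.Base using (Bool; true; false; not; if_then_else_)
open import Data.Bool.Properties using (not-involutive)
open import Data.Fin.Base as Fin using (Fin; toℕ)
import Data.Fin.Properties as Fin
open import Data.Fin.Subset using (Subset; ∣_∣; inside; outside; ⁅_⁆) renaming (⊤ to full; ⊥ to empty)
open import Data.Fin.Subset.Properties using (∣⊥∣≡0; ∣⊤∣≡n; ∣⁅x⁆∣≡1; ∣p∣≤n)
open import Data.Integer.Base as ℤ using ()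
import Data.Integer.Properties as ℤ
open import Data.Nat.Base as ℕ using (ℕ; zero; suc; _≤_; _<_; z≤n; s≤s)
open import Data.Nat.Induction using (<-wellFounded)
import Data.Nat.Properties as ℕ
open import Data.Product.Base using (Σ; Σ-syntax; ∃; ∃₂; _×_; _,_; proj₁; proj₂; map)
open import Data.Sum.Base using (_⊎_; inj₁; inj₂)
open import Data.Vec.Base as Vec using (Vec; []; _∷_; lookup; tabulate; replicate; last; _[_]%=_)
import Data.Vec.Properties as Vec
open import Data.Vec.Relation.Unary.Linked using ([]; [-]; _∷_)
open import Function.Base using (_∘_; _on_; case_of_)
open import Function.Definitions using (Injective; Surjective; Bijective)
open import Induction.WellFounded using (Acc; acc)
open import Level using (Level; _⊔_)
open import Relation.Binary.Bundles using (StrictPartialOrder)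
import Relation.Binary.Construct.StrictToNonStrict as NonStrict
open import Relation.Binary.Construct.Closure.ReflexiveTransitive using (Star; ε; _◅_; _◅◅_)
open import Relation.Binary.Core using (Rel)
open import Relation.Binary.Definitions using (tri<; tri≈; tri>)
open import Relation.Binary.PropositionalEquality as ≡ using (_≡_; _≢_)
import Relation.Binary.Reasoning.StrictPartialOrder as StrictPartialOrderReasoning
open import Relation.Binary.Structures using (IsStrictTotalOrder)
open import Relation.Nullary.Decidable using (yes; no; does; dec-true; dec-false; decidable-stable)
open import Relation.Nullary.Negation.Core using (¬_; contradiction)

-- Archimedean ordered fields

module OrderedField {a ℓ₁ ℓ₂ : Level} (K : ArchimedeanOrderedField a ℓ₁ ℓ₂) where

  open ArchimedeanOrderedField K public
  open IsStrictTotalOrder isStrictTotalOrder public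
    using (compare; isStrictPartialOrder)
    renaming (irrefl to <ᴷ-irrefl)
  open SemiringSolver commutativeSemiring public using (solve; _:=_; _:+_; _:*_; con)

  <ᴷ-strictPartialOrder : StrictPartialOrder a ℓ₁ ℓ₂
  <ᴷ-strictPartialOrder = record { isStrictPartialOrder = isStrictPartialOrder }

  module ≤ᴷ-Reasoning = StrictPartialOrderReasoning <ᴷ-strictPartialOrder
  open ≤ᴷ-Reasoning

  infix 4 _≤ᴷ_

  _≤ᴷ_ : Rel Carrier (ℓ₁ ⊔ ℓ₂)
  _≤ᴷ_ = NonStrict._≤_ _≈_ _<ᴷ_

  ≤ᴷ-refl : ∀ {x} → x ≤ᴷ x
  ≤ᴷ-refl = inj₂ refl

  ≤ᴷ-trans : ∀ {x y z} → x ≤ᴷ y → y ≤ᴷ z → x ≤ᴷ z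
  ≤ᴷ-trans x≤y y≤z = begin _ ≤⟨ x≤y ⟩ _ ≤⟨ y≤z ⟩ _ ∎

  ≰⇒> : ∀ {x y} → ¬ x ≤ᴷ y → y <ᴷ x
  ≰⇒> {x} {y} x≰y with compare x y
  ... | tri< x<y _ _ = contradiction (inj₁ x<y) x≰y
  ... | tri≈ _ x≈y _ = contradiction (inj₂ x≈y) x≰y
  ... | tri> _ _ y<x = y<x

  ≤⇒≯ : ∀ {x y} → x ≤ᴷ y → ¬ y <ᴷ x
  ≤⇒≯ {x} {y} x≤y y<x = <ᴷ-irrefl refl (begin-strict x ≤⟨ x≤y ⟩ y <⟨ y<x ⟩ x ∎)

  +-monoʳ-< : ∀ z {x y} → x <ᴷ y → z + x <ᴷ z + y
  +-monoʳ-< z {x} {y} x<y = begin-strict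
    z + x ≈⟨ +-comm z x ⟩
    x + z <⟨ +-monoˡ-< z x<y ⟩
    y + z ≈⟨ +-comm y z ⟩
    z + y ∎

  +-monoʳ-≤ : ∀ z {x y} → x ≤ᴷ y → z + x ≤ᴷ z + y
  +-monoʳ-≤ z (inj₁ x<y) = inj₁ (+-monoʳ-< z x<y)
  +-monoʳ-≤ z (inj₂ x≈y) = inj₂ (+-congˡ x≈y)

  +-monoˡ-≤ : ∀ z {x y} → x ≤ᴷ y → x + z ≤ᴷ y + z
  +-monoˡ-≤ z (inj₁ x<y) = inj₁ (+-monoˡ-< z x<y)
  +-monoˡ-≤ z (inj₂ x≈y) = inj₂ (+-congʳ x≈y)

  +-mono-≤ : ∀ {x y u v} → x ≤ᴷ y → u ≤ᴷ v → x + u ≤ᴷ y + v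
  +-mono-≤ x≤y u≤v = ≤ᴷ-trans (+-monoˡ-≤ _ x≤y) (+-monoʳ-≤ _ u≤v)

  +-cancelʳ-< : ∀ z {x y} → x + z <ᴷ y + z → x <ᴷ y
  +-cancelʳ-< z {x} {y} x+z<y+z with compare x y
  ... | tri< x<y _ _ = x<y
  ... | tri≈ _ x≈y _ = contradiction x+z<y+z (≤⇒≯ (+-monoˡ-≤ z (inj₂ (sym x≈y))))
  ... | tri> _ _ y<x = contradiction x+z<y+z (≤⇒≯ (+-monoˡ-≤ z (inj₁ y<x)))

  x<y⇒0<y-x : ∀ {x y} → x <ᴷ y → 0# <ᴷ y - x
  x<y⇒0<y-x {x} {y} x<y = begin-strict
    0#    ≈⟨ -‿inverseʳ x ⟨
    x - x <⟨ +-monoˡ-< (- x) x<y ⟩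
    y - x ∎

  x-y+y≈x : ∀ x y → (x - y) + y ≈ x
  x-y+y≈x x y = trans (+-assoc x (- y) y) (trans (+-congˡ (-‿inverseˡ y)) (+-identityʳ x))

  *-monoˡ-< : ∀ {z x y} → 0# <ᴷ z → x <ᴷ y → z * x <ᴷ z * y
  *-monoˡ-< {z} {x} {y} 0<z x<y = begin-strict
    z * x                 ≈⟨ +-identityˡ _ ⟨
    0# + z * x            <⟨ +-monoˡ-< _ (*-pos 0<z (x<y⇒0<y-x x<y)) ⟩
    z * (y - x) + z * x   ≈⟨ distribˡ z _ _ ⟨
    z * ((y - x) + x)     ≈⟨ *-congˡ (x-y+y≈x y x) ⟩
    z * y                 ∎

  *-monoˡ-≤ : ∀ {z x y} → 0# ≤ᴷ z → x ≤ᴷ y → z * x ≤ᴷ z * y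
  *-monoˡ-≤ (inj₁ 0<z) (inj₁ x<y) = inj₁ (*-monoˡ-< 0<z x<y)
  *-monoˡ-≤ _          (inj₂ x≈y) = inj₂ (*-congˡ x≈y)
  *-monoˡ-≤ {z} {x} {y} (inj₂ 0≈z) (inj₁ _) = inj₂ (begin-equality
    z * x  ≈⟨ *-congʳ 0≈z ⟨
    0# * x ≈⟨ zeroˡ x ⟩
    0#     ≈⟨ zeroˡ y ⟨
    0# * y ≈⟨ *-congʳ 0≈z ⟩
    z * y  ∎)

  *-nonneg : ∀ {x y} → 0# ≤ᴷ x → 0# ≤ᴷ y → 0# ≤ᴷ x * y
  *-nonneg {x} {y} 0≤x 0≤y = begin
    0#     ≈⟨ zeroʳ x ⟨
    x * 0# ≤⟨ *-monoˡ-≤ 0≤x 0≤y ⟩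
    x * y  ∎

  +-nonneg : ∀ {x y} → 0# ≤ᴷ x → 0# ≤ᴷ y → 0# ≤ᴷ x + y
  +-nonneg {x} {y} 0≤x 0≤y = begin
    0#      ≈⟨ +-identityʳ 0# ⟨
    0# + 0# ≤⟨ +-mono-≤ 0≤x 0≤y ⟩
    x + y   ∎

  ·-nonneg : ∀ k → 0# ≤ᴷ k · 1#
  ·-nonneg zero    = ≤ᴷ-refl
  ·-nonneg (suc k) = +-nonneg (inj₁ 0<1) (·-nonneg k)

  ·-pos : ∀ {k} → 0 ℕ.< k → 0# <ᴷ k · 1#
  ·-pos {suc k} _ = begin-strict
    0#           ≈⟨ +-identityʳ 0# ⟨
    0# + 0#      <⟨ +-monoˡ-< 0# 0<1 ⟩
    1# + 0#      ≤⟨ +-monoʳ-≤ 1# (·-nonneg k) ⟩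
    1# + k · 1#  ∎

  *-inverseʳ-pos : ∀ {x} → 0# <ᴷ x → x * x ⁻¹ ≈ 1#
  *-inverseʳ-pos 0<x = *-inverseʳ _ (λ x≈0 → <ᴷ-irrefl (sym x≈0) 0<x)

  ⁻¹-pos : ∀ {x} → 0# <ᴷ x → 0# <ᴷ x ⁻¹
  ⁻¹-pos {x} 0<x with compare 0# (x ⁻¹)
  ... | tri< 0<x⁻¹ _ _ = 0<x⁻¹
  ... | tri≈ _ 0≈x⁻¹ _ = contradiction 0<1 (≤⇒≯ (begin
    1#       ≈⟨ *-inverseʳ-pos 0<x ⟨
    x * x ⁻¹ ≈⟨ *-congˡ 0≈x⁻¹ ⟨
    x * 0#   ≈⟨ zeroʳ x ⟩
    0#       ∎))
  ... | tri> _ _ x⁻¹<0 = contradiction 0<1 (≤⇒≯ (begin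
    1#       ≈⟨ *-inverseʳ-pos 0<x ⟨
    x * x ⁻¹ ≤⟨ inj₁ (*-monoˡ-< 0<x x⁻¹<0) ⟩
    x * 0#   ≈⟨ zeroʳ x ⟩
    0#       ∎))

  infixr 8 _^ᴷ_

  _^ᴷ_ : Carrier → ℕ → Carrier
  x ^ᴷ zero  = 1#
  x ^ᴷ suc k = x * x ^ᴷ k

  ^-nonneg : ∀ {x} k → 0# ≤ᴷ x → 0# ≤ᴷ x ^ᴷ k
  ^-nonneg zero    0≤x = inj₁ 0<1
  ^-nonneg (suc k) 0≤x = *-nonneg 0≤x (^-nonneg k 0≤x)

  -- Bernoulli's inequality for 1/μ, multiplied through by μ^k.
  bernoulli : ∀ {μ ν} → 0# ≤ᴷ μ → 0# ≤ᴷ ν → μ + ν ≈ 1# →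
              ∀ k → μ ^ᴷ k * (1# + (k · 1#) * ν) ≤ᴷ 1#
  bernoulli {μ} {ν} 0≤μ 0≤ν μ+ν≈1 zero = inj₂ (begin-equality
    1# * (1# + 0# * ν) ≈⟨ solve 1 (λ x → con 1 :* (con 1 :+ con 0 :* x) := con 1) refl ν ⟩
    1#                 ∎)
  bernoulli {μ} {ν} 0≤μ 0≤ν μ+ν≈1 (suc k) = begin
    μ * m * (1# + (1# + k₁) * ν)  ≈⟨ solve 4 (λ μ m k ν → μ :* m :* (con 1 :+ (con 1 :+ k) :* ν)
                                        := m :* (μ :* (con 1 :+ (con 1 :+ k) :* ν))) refl μ m k₁ ν ⟩
    m * (μ * (1# + (1# + k₁) * ν)) ≤⟨ *-monoˡ-≤ (^-nonneg k 0≤μ) drop-μ ⟩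
    m * (1# + k₁ * ν)             ≤⟨ bernoulli 0≤μ 0≤ν μ+ν≈1 k ⟩
    1# ∎
    where
    m = μ ^ᴷ k
    k₁ = k · 1#
    s = (1# + k₁) * ν
    0≤s : 0# ≤ᴷ s
    0≤s = *-nonneg (·-nonneg (suc k)) 0≤ν
    -- Adding the non-negative term ν s completes μ s to s, and s + μ = 1 + kν because μ + ν = 1.
    drop-μ : μ * (1# + s) ≤ᴷ 1# + k₁ * ν
    drop-μ = begin
      μ * (1# + s)                 ≈⟨ solve 2 (λ μ s → μ :* (con 1 :+ s) := μ :* s :+ μ) refl μ s ⟩
      μ * s + μ                    ≈⟨ +-congʳ (+-identityʳ _) ⟨
      μ * s + 0# + μ               ≤⟨ +-monoˡ-≤ μ (+-monoʳ-≤ (μ * s) (*-nonneg 0≤ν 0≤s)) ⟩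
      μ * s + ν * s + μ            ≈⟨ solve 4 (λ μ ν s k → μ :* s :+ ν :* s :+ μ := (μ :+ ν) :* s :+ μ) refl μ ν s k₁ ⟩
      (μ + ν) * s + μ              ≈⟨ +-congʳ (*-congʳ μ+ν≈1) ⟩
      1# * s + μ                   ≈⟨ solve 3 (λ μ ν k → con 1 :* ((con 1 :+ k) :* ν) :+ μ
                                         := (μ :+ ν) :+ k :* ν) refl μ ν k₁ ⟩
      (μ + ν) + k₁ * ν             ≈⟨ +-congʳ μ+ν≈1 ⟩
      1# + k₁ * ν                  ∎

  -- Take k above 1/(νδ). If μ^k were at least δ, then kν μ^k would exceed 1, against Bernoulli's
  -- inequality.
  powers-vanish : ∀ {μ ν} → 0# ≤ᴷ μ → 0# <ᴷ ν → μ + ν ≈ 1# →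
                  ∀ {δ} → 0# <ᴷ δ → ∃ λ k → μ ^ᴷ k <ᴷ δ
  powers-vanish {μ} {ν} 0≤μ 0<ν μ+ν≈1 {δ} 0<δ
    with k , x<k ← archimedean ((ν * δ) ⁻¹) = k , small
    where
    0<νδ : 0# <ᴷ ν * δ
    0<νδ = *-pos 0<ν 0<δ
    small : μ ^ᴷ k <ᴷ δ
    small = ≰⇒> λ δ≤μ^k → ≤⇒≯ (bernoulli 0≤μ (inj₁ 0<ν) μ+ν≈1 k) (begin-strict
      1#                             ≈⟨ *-inverseʳ-pos 0<νδ ⟨
      ν * δ * (ν * δ) ⁻¹             <⟨ *-monoˡ-< 0<νδ x<k ⟩
      ν * δ * (k · 1#)               ≈⟨ solve 3 (λ ν δ k → ν :* δ :* k := k :* ν :* δ) refl ν δ (k · 1#) ⟩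
      (k · 1#) * ν * δ               ≤⟨ *-monoˡ-≤ (*-nonneg (·-nonneg k) (inj₁ 0<ν)) δ≤μ^k ⟩
      (k · 1#) * ν * μ ^ᴷ k          ≈⟨ +-identityˡ _ ⟨
      0# + (k · 1#) * ν * μ ^ᴷ k     ≤⟨ +-monoˡ-≤ _ (^-nonneg k 0≤μ) ⟩
      μ ^ᴷ k + (k · 1#) * ν * μ ^ᴷ k ≈⟨ solve 3 (λ m k ν → m :+ k :* ν :* m := m :* (con 1 :+ k :* ν))
                                          refl (μ ^ᴷ k) (k · 1#) ν ⟩
      μ ^ᴷ k * (1# + (k · 1#) * ν)   ∎)

-- Expectations of one step

-- Indexed by the answer of the toppling rule, so that a `with` on `next x` settles both which
-- constructor applies and which average `𝔼-step` takes.
data Outcome {m n} (x : Config m n) : Stable x ⊎ ∃ (Unstable x) → Config m n → Set where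
  adds    : ∀ {s} v → Outcome x (inj₁ s) (addGrain v x)
  topples : ∀ {v u} S → Outcome x (inj₂ (v , u)) (topple v S x)

module Steps {m n : ℕ} (rule : TopplingRule m n) where

  infix 4 _⟶_

  _⟶_ : Config m n → Config m n → Set
  x ⟶ y = Outcome x (TopplingRule.next rule x) y

module Averages {a ℓ₁ ℓ₂ : Level} (K : ArchimedeanOrderedField a ℓ₁ ℓ₂) where

  open OrderedField K
  open ≤ᴷ-Reasoning

  -- `ν` is the weight of one distinguished outcome, hence positive; `μ` is that of all the others
  -- together.
  record Weights : Set (a ⊔ ℓ₁ ⊔ ℓ₂) where
    constructor weights
    field
      μ ν   : Carrier
      0≤μ   : 0# ≤ᴷ μ
      0<ν   : 0# <ᴷ ν
      μ+ν≈1 : μ + ν ≈ 1#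

  open Weights public

  mix : Weights → Carrier → Carrier → Carrier
  mix W x y = μ W * x + ν W * y

  mix-idem : ∀ W x → mix W x x ≈ x
  mix-idem W x = trans (sym (distribʳ x (μ W) (ν W)))
                       (trans (*-congʳ (μ+ν≈1 W)) (*-identityˡ x))

  all-on-point : Weights
  all-on-point = weights 0# 1# ≤ᴷ-refl 0<1 (+-identityˡ 1#)

  mix-all-on-point : ∀ x y → mix all-on-point x y ≈ y
  mix-all-on-point x y = solve 2 (λ x y → con 0 :* x :+ con 1 :* y := y) refl x y

  infixr 7 _⊗_

  -- Two stages in succession: the distinguished outcome must occur in both, and a failure at either
  -- stage goes to `μ`.
  _⊗_ : Weights → Weights → Weights
  W ⊗ U = weights (μ W + ν W * μ U) (ν W * ν U)
    (+-nonneg (0≤μ W) (*-nonneg (inj₁ (0<ν W)) (0≤μ U)))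
    (*-pos (0<ν W) (0<ν U))
    (begin-equality
      μ W + ν W * μ U + ν W * ν U ≈⟨ solve 4 (λ a b c d → a :+ b :* c :+ b :* d := a :+ b :* (c :+ d))
                                       refl (μ W) (ν W) (μ U) (ν U) ⟩
      μ W + ν W * (μ U + ν U)     ≈⟨ +-congˡ (trans (*-congˡ (μ+ν≈1 U)) (*-identityʳ _)) ⟩
      μ W + ν W                   ≈⟨ μ+ν≈1 W ⟩
      1#                          ∎)

  mix-⊗ : ∀ W U x y → mix (W ⊗ U) x y ≈ mix W x (mix U x y)
  mix-⊗ W U x y = solve 6 (λ a b c d x y → (a :+ b :* c) :* x :+ b :* d :* y
                                        := a :* x :+ b :* (c :* x :+ d :* y))
                    refl (μ W) (ν W) (μ U) (ν U) x y

  mix-monoʳ-≤ : ∀ W x {y z} → y ≤ᴷ z → mix W x y ≤ᴷ mix W x z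
  mix-monoʳ-≤ W x y≤z = +-monoʳ-≤ _ (*-monoˡ-≤ (inj₁ (0<ν W)) y≤z)

  mix-monoˡ-≤ : ∀ W {x y} z → x ≤ᴷ y → mix W x z ≤ᴷ mix W y z
  mix-monoˡ-≤ W z x≤y = +-monoˡ-≤ _ (*-monoˡ-≤ (0≤μ W) x≤y)

  mix-≤ʳ : ∀ W {x y} → x ≤ᴷ y → mix W x y ≤ᴷ y
  mix-≤ʳ W {x} {y} x≤y = begin
    mix W x y ≤⟨ mix-monoˡ-≤ W y x≤y ⟩
    mix W y y ≈⟨ mix-idem W y ⟩
    y         ∎

  mix-≥ˡ : ∀ W {x y} → x ≤ᴷ y → x ≤ᴷ mix W x y
  mix-≥ˡ W {x} {y} x≤y = begin
    x         ≈⟨ mix-idem W x ⟨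
    mix W x x ≤⟨ mix-monoʳ-≤ W x x≤y ⟩
    mix W x y ∎

  mix-<ˡ : ∀ W {x y} → y <ᴷ x → mix W x y <ᴷ x
  mix-<ˡ W {x} {y} y<x = begin-strict
    mix W x y <⟨ +-monoʳ-< _ (*-monoˡ-< (0<ν W) y<x) ⟩
    mix W x x ≈⟨ mix-idem W x ⟩
    x         ∎

  -- A product gives the larger value less weight than either factor does, so it can replace both
  -- factors in lower bounds; this makes weights uniform over finitely many configurations.
  ⊗-weakenˡ : ∀ W U {x y} → x ≤ᴷ y → mix (W ⊗ U) x y ≤ᴷ mix W x y
  ⊗-weakenˡ W U {x} {y} x≤y = begin
    mix (W ⊗ U) x y       ≈⟨ mix-⊗ W U x y ⟩
    mix W x (mix U x y)   ≤⟨ mix-monoʳ-≤ W x (mix-≤ʳ U x≤y) ⟩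
    mix W x y             ∎

  ⊗-weakenʳ : ∀ W U {x y} → x ≤ᴷ y → mix (W ⊗ U) x y ≤ᴷ mix U x y
  ⊗-weakenʳ W U {x} {y} x≤y = begin
    mix (W ⊗ U) x y       ≈⟨ mix-⊗ W U x y ⟩
    mix W x (mix U x y)   ≤⟨ mix-≤ʳ W (mix-≥ˡ U x≤y) ⟩
    mix U x y             ∎

  -- Lower and upper bounds on expectations are the cases _≼_ = _≤ᴷ_ and
  -- _≼_ = flip _≤ᴷ_ of the same argument.
  record IsBound (_≼_ : Rel Carrier (ℓ₁ ⊔ ℓ₂)) : Set (a ⊔ ℓ₁ ⊔ ℓ₂) where
    field
      ≈⇒≼ : ∀ {x y} → x ≈ y → x ≼ y
      trans≼    : ∀ {x y z} → x ≼ y → y ≼ z → x ≼ z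
      +-mono    : ∀ {x y u v} → x ≼ y → u ≼ v → (x + u) ≼ (y + v)
      *-monoˡ   : ∀ {z x y} → 0# ≤ᴷ z → x ≼ y → (z * x) ≼ (z * y)

  lower : IsBound _≤ᴷ_
  lower = record
    { ≈⇒≼ = inj₂ ; trans≼ = ≤ᴷ-trans ; +-mono = +-mono-≤ ; *-monoˡ = *-monoˡ-≤ }

  upper : IsBound (λ x y → y ≤ᴷ x)
  upper = record
    { ≈⇒≼ = λ x≈y → inj₂ (sym x≈y) ; trans≼ = λ y≤x z≤y → ≤ᴷ-trans z≤y y≤x
    ; +-mono = +-mono-≤ ; *-monoˡ = *-monoˡ-≤ }

  module Expectation (p : Carrier) (0<p : 0# <ᴷ p) (p<1 : p <ᴷ 1#)
                     {m n : ℕ} (0<n : 0 ℕ.< n) (rule : TopplingRule m n) where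

    open Chain K p rule public
    open Steps rule public
    open Sums +-commutativeMonoid using (sum)
    open MultProperties semiring using (×-homo-+)

    ·-pred : ∀ {k} → Fin k → 1# + ℕ.pred k · 1# ≈ k · 1#
    ·-pred {suc k} _ = refl

    successor : ∀ x → ∃ (x ⟶_)
    successor x with TopplingRule.next rule x
    ... | inj₁ s       = _ , adds (bottom (Fin.fromℕ< 0<n))
    ... | inj₂ (v , u) = _ , topples full

    -- The coin thrown for one neighbour, with `ν` the probability of the named result.
    sent kept : Weights
    sent = weights (1# - p) p (inj₁ (x<y⇒0<y-x p<1)) 0<p (x-y+y≈x 1# p)
    kept = weights p (1# - p) (inj₁ 0<p) (x<y⇒0<y-x p<1)
             (trans (+-comm _ _) (x-y+y≈x 1# p))

    module _ {_≼_ : Rel Carrier (ℓ₁ ⊔ ℓ₂)} (isBound : IsBound _≼_) where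
      open IsBound isBound

      -- The weights come before the bounds and the integrand, so they are the same for all visit
      -- probabilities.
      Bounds : {I : Set} → ((I → Carrier) → Carrier) → I → Set (a ⊔ ℓ₁ ⊔ ℓ₂)
      Bounds 𝔼 i = Σ[ W ∈ Weights ] ∀ x y h → (∀ j → x ≼ h j) → y ≼ h i → mix W x y ≼ 𝔼 h

      bounds-const : ∀ {I : Set} {𝔼 : (I → Carrier) → Carrier} {i} → Bounds 𝔼 i →
                     ∀ x h → (∀ j → x ≼ h j) → x ≼ 𝔼 h
      bounds-const (W , bound) x h x≼h =
        trans≼ (≈⇒≼ (sym (mix-idem W x))) (bound x x h x≼h (x≼h _))

      -- The branch of the first coin that agrees with `S` gets the inductive bound, the other one
      -- the constant bound `x`.
      𝔼-subset-bounds : ∀ k S → Bounds (𝔼-subset k) S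
      𝔼-subset-bounds zero [] = all-on-point , λ x y h _ y≼h →
        trans≼ (≈⇒≼ (mix-all-on-point x y)) y≼h
      𝔼-subset-bounds (suc k) (inside ∷ S)
        with rec@(W , bound) ← 𝔼-subset-bounds k S = sent ⊗ W , λ x y h x≼h y≼h →
          trans≼ (≈⇒≼ (trans (mix-⊗ sent W x y) (+-comm _ _)))
            (+-mono (*-monoˡ (inj₁ (0<ν sent)) (bound x y _ (λ S′ → x≼h _) y≼h))
                    (*-monoˡ (inj₁ (0<ν kept)) (bounds-const rec x _ (λ S′ → x≼h _))))
      𝔼-subset-bounds (suc k) (outside ∷ S)
        with rec@(W , bound) ← 𝔼-subset-bounds k S = kept ⊗ W , λ x y h x≼h y≼h →
          trans≼ (≈⇒≼ (mix-⊗ kept W x y))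
            (+-mono (*-monoˡ (inj₁ (0<ν sent)) (bounds-const rec x _ (λ S′ → x≼h _)))
                    (*-monoˡ (inj₁ (0<ν kept)) (bound x y _ (λ S′ → x≼h _) y≼h)))

      sum-bound : ∀ k x (h : Fin k → Carrier) → (∀ j → x ≼ h j) → ((k · 1#) * x) ≼ sum h
      sum-bound zero    x h x≼h = ≈⇒≼ (zeroˡ x)
      sum-bound (suc k) x h x≼h =
        trans≼ (≈⇒≼ (trans (distribʳ x 1# (k · 1#)) (+-congʳ (*-identityˡ x))))
               (+-mono (x≼h Fin.zero) (sum-bound k x _ (λ j → x≼h (Fin.suc j))))

      sum-bound-at : ∀ {k} (i : Fin k) x y h → (∀ j → x ≼ h j) → y ≼ h i →
                     ((ℕ.pred k · 1#) * x + y) ≼ sum h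
      sum-bound-at Fin.zero x y h x≼h y≼h =
        trans≼ (≈⇒≼ (+-comm _ y)) (+-mono y≼h (sum-bound _ x _ (λ j → x≼h (Fin.suc j))))
      sum-bound-at {suc (suc k)} (Fin.suc i) x y h x≼h y≼h =
        trans≼ (≈⇒≼ (solve 3 (λ k x y → (con 1 :+ k) :* x :+ y := x :+ (k :* x :+ y)) refl (k · 1#) x y))
               (+-mono (x≼h Fin.zero) (sum-bound-at i x y _ (λ j → x≼h (Fin.suc j)) y≼h))

      module _ {k : ℕ} (0<k : 0 ℕ.< k) {u : Carrier} (0≤u : 0# ≤ᴷ u) (1+u≈k : 1# + u ≈ k · 1#) where

        -- The field element `u` is k - 1, the number of undistinguished vertices. It is a parameter
        -- because it arises as (m - 1) + n or as m + (n - 1).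
        uniform : Weights
        uniform = weights ((k · 1#) ⁻¹ * u) ((k · 1#) ⁻¹)
          (*-nonneg (inj₁ (⁻¹-pos (·-pos 0<k))) 0≤u) (⁻¹-pos (·-pos 0<k))
          (begin-equality
            (k · 1#) ⁻¹ * u + (k · 1#) ⁻¹ ≈⟨ solve 2 (λ i u → i :* u :+ i := (con 1 :+ u) :* i) refl _ u ⟩
            (1# + u) * (k · 1#) ⁻¹        ≈⟨ *-congʳ 1+u≈k ⟩
            (k · 1#) * (k · 1#) ⁻¹        ≈⟨ *-inverseʳ-pos (·-pos 0<k) ⟩
            1#                            ∎)

        uniform-bound : ∀ x y {z} → (u * x + y) ≼ z → mix uniform x y ≼ ((k · 1#) ⁻¹ * z)
        uniform-bound x y bound = trans≼
          (≈⇒≼ (solve 4 (λ i u x y → i :* u :* x :+ i :* y := i :* (u :* x :+ y)) refl _ u x y))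
          (*-monoˡ (inj₁ (⁻¹-pos (·-pos 0<k))) bound)

      0<m+n : 0 ℕ.< m ℕ.+ n
      0<m+n = ℕ.≤-trans 0<n (ℕ.m≤n+m n m)

      𝔼-vertex-bounds : ∀ v → Bounds 𝔼-vertex v
      𝔼-vertex-bounds (top i) = uniform 0<m+n 0≤u 1+u , λ x y h x≼h y≼h →
          uniform-bound 0<m+n 0≤u 1+u x y (trans≼
            (≈⇒≼ (solve 4 (λ s t x y → (s :+ t) :* x :+ y := (s :* x :+ y) :+ t :* x) refl _ _ x y))
            (+-mono (sum-bound-at i x y _ (λ j → x≼h (top j)) y≼h)
                    (sum-bound n x _ (λ j → x≼h (bottom j)))))
        where
        0≤u = +-nonneg (·-nonneg (ℕ.pred m)) (·-nonneg n)
        1+u : 1# + (ℕ.pred m · 1# + n · 1#) ≈ (m ℕ.+ n) · 1#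
        1+u = trans (sym (+-assoc _ _ _)) (trans (+-congʳ (·-pred i)) (sym (×-homo-+ 1# m n)))
      𝔼-vertex-bounds (bottom j) = uniform 0<m+n 0≤u 1+u , λ x y h x≼h y≼h →
          uniform-bound 0<m+n 0≤u 1+u x y (trans≼
            (≈⇒≼ (solve 4 (λ s t x y → (s :+ t) :* x :+ y := s :* x :+ (t :* x :+ y)) refl _ _ x y))
            (+-mono (sum-bound m x _ (λ i → x≼h (top i)))
                    (sum-bound-at j x y _ (λ i → x≼h (bottom i)) y≼h)))
        where
        0≤u = +-nonneg (·-nonneg m) (·-nonneg (ℕ.pred n))
        1+u : 1# + (m · 1# + ℕ.pred n · 1#) ≈ (m ℕ.+ n) · 1#
        1+u = trans (solve 3 (λ o s t → o :+ (s :+ t) := s :+ (o :+ t)) refl 1# _ _)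
                    (trans (+-congˡ (·-pred j)) (sym (×-homo-+ 1# m n)))

      𝔼-step-bounds : ∀ {x y} → x ⟶ y →
        Σ[ W ∈ Weights ] ∀ a g h → (∀ z → x ⟶ z → a ≼ h z) → g ≼ h y → mix W a g ≼ 𝔼-step x h
      𝔼-step-bounds {x} x⟶y with TopplingRule.next rule x
      𝔼-step-bounds (adds v) | inj₁ s with W , bound ← 𝔼-vertex-bounds v =
        W , λ a g h a≼h → bound a g _ (λ w → a≼h _ (adds w))
      𝔼-step-bounds (topples S) | inj₂ (v , u) with W , bound ← 𝔼-subset-bounds (degree v) S =
        W , λ a g h a≼h → bound a g _ (λ S′ → a≼h _ (topples S′))

      -- Any successor may be distinguished: with `a` as both bounds the weights add up to 1.
      𝔼-step-bound : ∀ x a h → (∀ z → x ⟶ z → a ≼ h z) → a ≼ 𝔼-step x h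
      𝔼-step-bound x a h a≼h with y , x⟶y ← successor x with W , bound ← 𝔼-step-bounds x⟶y =
        trans≼ (≈⇒≼ (sym (mix-idem W a))) (bound a a h a≼h (a≼h y x⟶y))

-- Visits of the chain to a configuration

total : ∀ {m n} → Config m n → ℕ
total (t , b) = Vec.sum t ℕ.+ Vec.sum b

-- Finitely many configurations have at most M grains, so witnesses found one by one combine under
-- `_∙_` into a single witness for all of them.
module BoundedChoice {i : Level} {I : Set i} (_∙_ : I → I → I) where

  Weakening : ∀ {a r} {A : Set a} → (A → I → Set r) → Set (a ⊔ i ⊔ r)
  Weakening P = ∀ {x i j} → (P x i → P x (i ∙ j)) × (P x j → P x (i ∙ j))

  choice-ℕ : ∀ {r} {P : ℕ → I → Set r} → Weakening P → (∀ x → ∃ (P x)) →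
             ∀ M → ∃ λ i → ∀ x → x ≤ M → P x i
  choice-ℕ weaken choose zero with i , Pi ← choose 0 = i , λ { zero z≤n → Pi }
  choice-ℕ {P = P} weaken choose (suc M)
    with i , Pi ← choose (suc M) | j , Pj ← choice-ℕ {P = P} weaken choose M = i ∙ j , bound
    where
    bound : ∀ x → x ≤ suc M → P x (i ∙ j)
    bound x x≤1+M with ℕ.m≤n⇒m<n∨m≡n x≤1+M
    ... | inj₁ (s≤s x≤M) = proj₂ weaken (Pj x x≤M)
    ... | inj₂ ≡.refl    = proj₁ weaken Pi

  choice-Vec : ∀ {r k} {P : Vec ℕ k → I → Set r} → Weakening P → (∀ v → ∃ (P v)) →
               ∀ M → ∃ λ i → ∀ v → Vec.sum v ≤ M → P v i
  choice-Vec {k = zero} weaken choose M with i , Pi ← choose [] = i , λ { [] _ → Pi }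
  choice-Vec {k = suc k} {P} weaken choose M
    with i , Pi ← choice-ℕ {P = λ x i → ∀ v → Vec.sum v ≤ M → P (x ∷ v) i}
                    ((λ Pi v v≤M → proj₁ weaken (Pi v v≤M)) , (λ Pi v v≤M → proj₂ weaken (Pi v v≤M)))
                    (λ x → choice-Vec {P = λ v → P (x ∷ v)} weaken (λ v → choose (x ∷ v)) M) M
    = i , λ { (x ∷ v) x+v≤M → Pi x (ℕ.m+n≤o⇒m≤o x x+v≤M) v (ℕ.m+n≤o⇒n≤o x x+v≤M) }

  choice-Config : ∀ {r m n} {P : Config m n → I → Set r} → Weakening P → (∀ x → ∃ (P x)) →
                  ∀ M → ∃ λ i → ∀ x → total x ≤ M → P x i
  choice-Config {P = P} weaken choose M
    with i , Pi ← choice-Vec {P = λ t i → ∀ b → Vec.sum b ≤ M → P (t , b) i}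
                    ((λ Pi b b≤M → proj₁ weaken (Pi b b≤M)) , (λ Pi b b≤M → proj₂ weaken (Pi b b≤M)))
                    (λ t → choice-Vec {P = λ b → P (t , b)} weaken (λ b → choose (t , b)) M) M
    = i , λ { (t , b) t+b≤M → Pi t (ℕ.m+n≤o⇒m≤o _ t+b≤M) b (ℕ.m+n≤o⇒n≤o (Vec.sum t) t+b≤M) }

module Recurrence {a ℓ₁ ℓ₂ : Level} (K : ArchimedeanOrderedField a ℓ₁ ℓ₂)
                  (p : ArchimedeanOrderedField.Carrier K)
                  (0<p : ArchimedeanOrderedField._<ᴷ_ K (ArchimedeanOrderedField.0# K) p)
                  (p<1 : ArchimedeanOrderedField._<ᴷ_ K p (ArchimedeanOrderedField.1# K))
                  {m n : ℕ} (0<n : 0 < n) (rule : TopplingRule m n) where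

  open OrderedField K
  open Averages K
  open Expectation p 0<p p<1 0<n rule
  open ≤ᴷ-Reasoning

  ℙ-visits≥0 : ∀ c N T x → 0# ≤ᴷ ℙ-visits c N T x
  ℙ-visits≥0 c zero    T       x = inj₁ 0<1
  ℙ-visits≥0 c (suc N) zero    x = ≤ᴷ-refl
  ℙ-visits≥0 c (suc N) (suc T) x = 𝔼-step-bound lower x 0# _ (λ z _ → ℙ-visits≥0 c (if does (x ≟ᶜ c) then N else suc N) T z)

  ℙ-visits≤1 : ∀ c N T x → ℙ-visits c N T x ≤ᴷ 1#
  ℙ-visits≤1 c zero    T       x = ≤ᴷ-refl
  ℙ-visits≤1 c (suc N) zero    x = inj₁ 0<1
  ℙ-visits≤1 c (suc N) (suc T) x = 𝔼-step-bound upper x 1# _ (λ z _ → ℙ-visits≤1 c (if does (x ≟ᶜ c) then N else suc N) T z)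

  -- Each return to c before P is entered uses up one step of the path.
  module _ {c : Config m n} {P : Config m n → Set} (closed : ∀ {x y} → P x → x ⟶ y → P y) (¬Pc : ¬ P c) where

    no-visits : ∀ N T {x} → P x → ℙ-visits c (suc N) T x ≤ᴷ 0#
    no-visits N zero    Px = ≤ᴷ-refl
    no-visits N (suc T) {x} Px with x ≟ᶜ c
    ... | yes ≡.refl = contradiction Px ¬Pc
    ... | no  _      = 𝔼-step-bound upper x 0# _ (λ z x⟶z → no-visits N T (closed Px x⟶z))

    few-visits : ∀ {x y} → Star _⟶_ x y → P y →
                 ∃ λ u → u <ᴷ 1# × ∃ λ k → ∀ N → k ≤ N → ∀ T → ℙ-visits c (suc N) T x ≤ᴷ u
    few-visits ε Py = 0# , 0<1 , 0 , λ N _ T → no-visits N T Py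
    few-visits {x} (x⟶y ◅ path) Py
      with W , bound ← 𝔼-step-bounds upper x⟶y
         | u , u<1 , k , visits≤u ← few-visits path Py
      = mix W 1# u , mix-<ˡ W u<1 , suc k , λ { (suc N) (s≤s k≤N) T → visits N k≤N T }
      where
      -- At time 0 a positive number of visits has probability 0, and `u` bounds this too.
      0≤u : 0# ≤ᴷ u
      0≤u = visits≤u k ℕ.≤-refl 0
      visits : ∀ N → k ≤ N → ∀ T → ℙ-visits c (suc (suc N)) T x ≤ᴷ mix W 1# u
      visits N k≤N zero    = ≤ᴷ-trans 0≤u (≤ᴷ-trans (inj₂ (sym (mix-idem W u))) (mix-monoˡ-≤ W u (inj₁ u<1)))
      visits N k≤N (suc T) with x ≟ᶜ c
      ... | yes _ = bound 1# u _ (λ z _ → ℙ-visits≤1 c (suc N) T z) (visits≤u N k≤N T)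
      ... | no  _ = bound 1# u _ (λ z _ → ℙ-visits≤1 c (suc (suc N)) T z) (visits≤u (suc N) (ℕ.m≤n⇒m≤1+n k≤N) T)

    -- Infinitely many visits, used with ε = 1 - u, would make more than k visits likelier than `u`.
    transient : ∀ {y} → Star _⟶_ c y → P y → ¬ InfinitelyOften c
    transient path Py often
      with u , u<1 , k , visits≤u ← few-visits path Py
      with T , likely ← often (suc k) (1# - u) (x<y⇒0<y-x u<1)
      = ≤⇒≯ (visits≤u k ℕ.≤-refl T) (begin-strict
        u                    ≈⟨ +-identityʳ u ⟨
        u + 0#               ≈⟨ +-congˡ (-‿inverseʳ (1# - u)) ⟨
        u + ((1# - u) - (1# - u)) ≈⟨ +-assoc _ _ _ ⟨
        u + (1# - u) - (1# - u)   ≈⟨ +-congʳ (trans (+-comm _ _) (x-y+y≈x 1# u)) ⟩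
        1# - (1# - u)        <⟨ likely ⟩
        ℙ-visits c (suc k) T c ∎)

  module _ {c : Config m n} (M : ℕ) (closed : ∀ {x y} → total x ≤ M → x ⟶ y → total y ≤ M)
           (c≤M : total c ≤ M) (return : ∀ x → Star _⟶_ x c) where

    -- Stated for all times from `T` on, so that the bound applies with whatever time is left after
    -- some steps.
    VisitsAtLeast : ℕ → ℕ → Carrier → Set (ℓ₁ ⊔ ℓ₂)
    VisitsAtLeast N T g = ∀ T′ → T ≤ T′ → ∀ x → total x ≤ M → g ≤ᴷ ℙ-visits c N T′ x

    visit-now : ∀ N {T g} → VisitsAtLeast N T g → ∀ T′ → T ≤ T′ → g ≤ᴷ ℙ-visits c (suc N) (suc T′) c
    visit-now N visits T′ T≤T′ with c ≟ᶜ c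
    ... | yes _   = 𝔼-step-bound lower c _ _ (λ z c⟶z → visits T′ T≤T′ z (closed c≤M c⟶z))
    ... | no  c≢c = contradiction ≡.refl c≢c

    -- h and g bound the probabilities of N + 1 and of N visits from anywhere; a
    -- return to c within L steps, which has weight ν W, improves h towards g.
    ReturnBound : Config m n → ℕ × Weights → Set (a ⊔ ℓ₁ ⊔ ℓ₂)
    ReturnBound x (L , W) = ∀ N {T h g} → h ≤ᴷ g → VisitsAtLeast (suc N) T h → VisitsAtLeast N T g →
                            ∀ T′ → T ℕ.+ L ≤ T′ → mix W h g ≤ᴷ ℙ-visits c (suc N) T′ x

    return-bound : ∀ {x} → Star _⟶_ x c → total x ≤ M → ∃ (ReturnBound x)
    -- A visit is counted only when a step is taken from it, so one unit of time is spent even at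
    -- `c` itself.
    return-bound ε _ = (1 , all-on-point) , λ where
      N {T = T} h≤g _ visits zero    T+1≤0  → contradiction (ℕ.≤-trans (ℕ.m≤n+m 1 T) T+1≤0) λ ()
      N {T = T} h≤g _ visits (suc T′) T+1≤T′ →
        ≤ᴷ-trans (inj₂ (mix-all-on-point _ _))
          (visit-now N visits T′ (ℕ.≤-pred (≡.subst (_≤ suc T′) (ℕ.+-comm T 1) T+1≤T′)))
    return-bound {x} (x⟶y ◅ path) x≤M
      with W , bound ← 𝔼-step-bounds lower x⟶y
         | (L , U) , later ← return-bound path (closed x≤M x⟶y)
      = (suc L , W ⊗ U) , now
      where
      now : ReturnBound x (suc L , W ⊗ U)
      now N {T = T} h≤g _ _ zero T+1+L≤0 =
        contradiction (ℕ.≤-trans (ℕ.m+n≤o⇒n≤o T ℕ.≤-refl) T+1+L≤0) λ ()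
      now N {T} {h} {g} h≤g visitsʰ visitsᵍ (suc T′) T+1+L≤1+T′
        with T+L≤T′ ← ℕ.≤-pred (≡.subst (_≤ suc T′) (ℕ.+-suc T L) T+1+L≤1+T′)
        with T≤T′ ← ℕ.m+n≤o⇒m≤o T T+L≤T′
        with x ≟ᶜ c
      -- The path may meet `c` before its end; that visit is counted at once and yields the better
      -- bound `g`.
      ... | yes _ = ≤ᴷ-trans (mix-≤ʳ (W ⊗ U) h≤g)
                      (𝔼-step-bound lower x _ _ (λ z x⟶z → visitsᵍ T′ T≤T′ z (closed x≤M x⟶z)))
      ... | no  _ = ≤ᴷ-trans (inj₂ (mix-⊗ W U h g))
                      (bound h _ _ (λ z x⟶z → visitsʰ T′ T≤T′ z (closed x≤M x⟶z))
                             (later N h≤g visitsʰ visitsᵍ T′ T+L≤T′))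

    -- Longer times and products of weights only weaken a return bound, so the maximum of the
    -- lengths and the product of the weights serve all configurations with at most `M` grains.
    uniform-return : ∃ λ i → ∀ x → total x ≤ M → ReturnBound x i
    uniform-return = proj₁ uniformly , λ x x≤M → proj₂ uniformly x x≤M x≤M
      where
      combine : ℕ × Weights → ℕ × Weights → ℕ × Weights
      combine (L , W) (L′ , W′) = L ℕ.⊔ L′ , W ⊗ W′
      open BoundedChoice combine
      weaken : Weakening (λ x i → total x ≤ M → ReturnBound x i)
      weaken {i = L , W} {j = L′ , W′}
        = (λ bound x≤M N {T} h≤g vʰ vᵍ T′ T≤T′ → ≤ᴷ-trans (⊗-weakenˡ W W′ h≤g)
             (bound x≤M N h≤g vʰ vᵍ T′ (ℕ.≤-trans (ℕ.+-monoʳ-≤ T (ℕ.m≤m⊔n L L′)) T≤T′)))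
        , (λ bound x≤M N {T} h≤g vʰ vᵍ T′ T≤T′ → ≤ᴷ-trans (⊗-weakenʳ W W′ h≤g)
             (bound x≤M N h≤g vʰ vᵍ T′ (ℕ.≤-trans (ℕ.+-monoʳ-≤ T (ℕ.m≤n⊔m L L′)) T≤T′)))
      choose : ∀ x → ∃ λ i → total x ≤ M → ReturnBound x i
      choose x with total x ℕ.≤? M
      ... | no  x≰M = (0 , all-on-point) , λ x≤M → contradiction x≤M x≰M
      ... | yes x≤M with i , bound ← return-bound (return x) x≤M = i , λ _ → bound
      uniformly : ∃ λ i → ∀ x → total x ≤ M → total x ≤ M → ReturnBound x i
      uniformly = choice-Config {P = λ x i → total x ≤ M → ReturnBound x i}
                    (λ {x} {i} {j} → weaken {x} {i} {j}) choose M

    module _ {L : ℕ} {W : Weights} (uniform : ∀ x → total x ≤ M → ReturnBound x (L , W)) where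

      module _ (N : ℕ) {T : ℕ} {g : Carrier} (0≤g : 0# ≤ᴷ g) (visits : VisitsAtLeast N T g) where

        -- Lower bounds for N + 1 visits, improved once in every `L` units of time; the gap to `g`
        -- shrinks by the factor `μ W` each time.
        approach : ℕ → Carrier
        approach zero    = 0#
        approach (suc k) = mix W (approach k) g

        approach-gap : ∀ k → approach k + μ W ^ᴷ k * g ≈ g
        approach-gap zero    = solve 1 (λ g → con 0 :+ con 1 :* g := g) refl g
        approach-gap (suc k) = begin-equality
          mix W (approach k) g + μ W * m′ * g     ≈⟨ solve 5 (λ u v h m g → (u :* h :+ v :* g) :+ u :* m :* g
                                                     := u :* (h :+ m :* g) :+ v :* g) refl (μ W) (ν W) (approach k) m′ g ⟩
          μ W * (approach k + m′ * g) + ν W * g   ≈⟨ +-congʳ (*-congˡ (approach-gap k)) ⟩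
          mix W g g                                ≈⟨ mix-idem W g ⟩
          g                                         ∎
          where m′ = μ W ^ᴷ k

        0≤gap : ∀ k → 0# ≤ᴷ μ W ^ᴷ k * g
        0≤gap k = *-nonneg (^-nonneg k (0≤μ W)) 0≤g

        approach≤ : ∀ k → approach k ≤ᴷ g
        approach≤ k = begin
          approach k                   ≈⟨ +-identityʳ _ ⟨
          approach k + 0#              ≤⟨ +-monoʳ-≤ _ (0≤gap k) ⟩
          approach k + μ W ^ᴷ k * g   ≈⟨ approach-gap k ⟩
          g                            ∎

        approach≥0 : ∀ k → 0# ≤ᴷ approach k
        approach≥0 zero    = ≤ᴷ-refl
        approach≥0 (suc k) = +-nonneg (*-nonneg (0≤μ W) (approach≥0 k)) (*-nonneg (inj₁ (0<ν W)) 0≤g)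

        approach-visits : ∀ k → VisitsAtLeast (suc N) (T ℕ.+ k ℕ.* L) (approach k)
        approach-visits zero    T′ _ x x≤M = ℙ-visits≥0 c (suc N) T′ x
        approach-visits (suc k) T′ T≤T′ x x≤M =
          uniform x x≤M N (approach≤ k) (approach-visits k)
            (λ T″ T≤T″ → visits T″ (ℕ.m+n≤o⇒m≤o T T≤T″)) T′
            (≡.subst (_≤ T′) (≡.trans (≡.cong (T ℕ.+_) (ℕ.+-comm L _)) (≡.sym (ℕ.+-assoc T _ L))) T≤T′)

      -- The strict inequality leaves a slack g + δ - 1. The loss μ^k g caused by asking for one
      -- more visit is pushed below it, so the same δ serves for every `N`.
      visits-likely : ∀ N δ → 0# <ᴷ δ →
                      ∃ λ T → ∃ λ g → 0# ≤ᴷ g × g ≤ᴷ 1# × 1# <ᴷ g + δ × VisitsAtLeast N T g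
      visits-likely zero δ 0<δ = 0 , 1# , inj₁ 0<1 , ≤ᴷ-refl ,
        (begin-strict 1# ≈⟨ +-identityʳ 1# ⟨ 1# + 0# <⟨ +-monoʳ-< 1# 0<δ ⟩ 1# + δ ∎) ,
        λ T′ _ x _ → ≤ᴷ-refl
      visits-likely (suc N) δ 0<δ
        with T , g , 0≤g , g≤1 , 1<g+δ , visits ← visits-likely N δ 0<δ
        with k , μ^k<gap ← powers-vanish (0≤μ W) (0<ν W) (μ+ν≈1 W) (x<y⇒0<y-x 1<g+δ)
        = T ℕ.+ k ℕ.* L , h , approach≥0 N 0≤g visits k , ≤ᴷ-trans (approach≤ N 0≤g visits k) g≤1
        , +-cancelʳ-< (μ W ^ᴷ k * g) (begin-strict
            1# + μ W ^ᴷ k * g          ≤⟨ +-monoʳ-≤ 1# (*-monoˡ-≤ (^-nonneg k (0≤μ W)) g≤1) ⟩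
            1# + μ W ^ᴷ k * 1#         ≈⟨ +-congˡ (*-identityʳ _) ⟩
            1# + μ W ^ᴷ k              <⟨ +-monoʳ-< 1# μ^k<gap ⟩
            1# + (g + δ - 1#)           ≈⟨ trans (+-comm _ _) (x-y+y≈x _ 1#) ⟩
            g + δ                       ≈⟨ +-congʳ (approach-gap N 0≤g visits k) ⟨
            h + μ W ^ᴷ k * g + δ       ≈⟨ solve 3 (λ h x δ → h :+ x :+ δ := h :+ δ :+ x) refl h _ δ ⟩
            h + δ + μ W ^ᴷ k * g       ∎)
        , approach-visits N 0≤g visits k
        where h = approach N 0≤g visits k

      often : InfinitelyOften c
      often N δ 0<δ with T , g , _ , _ , 1<g+δ , visits ← visits-likely N δ 0<δ
        = T , +-cancelʳ-< δ (begin-strict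
          1# - δ + δ            ≈⟨ x-y+y≈x 1# δ ⟩
          1#                    <⟨ 1<g+δ ⟩
          g + δ                 ≤⟨ +-monoˡ-≤ δ (visits T ℕ.≤-refl c c≤M) ⟩
          ℙ-visits c N T c + δ  ∎)

    recurrent : InfinitelyOften c
    recurrent = often {proj₁ (proj₁ uniform-return)} {proj₂ (proj₁ uniform-return)} (proj₂ uniform-return)

open import Data.Nat.Base using (_+_; _*_; _∸_; _<ᵇ_; ∣_-_∣)
open import Algebra.Properties.CommutativeSemigroup ℕ.+-commutativeSemigroup using (x∙yz≈y∙xz)
open ≡ using (refl; sym; trans; cong; cong₂; subst; subst₂; module ≡-Reasoning)
open Sums ℕ.+-0-commutativeMonoid using (sum; ∑-comm; ∑-distrib-+; sum-cong-≗)

-- Partial sums and operations on Ferrers diagrams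

Increasing-irrelevant : ∀ {n} {v : Vec ℕ n} (p q : Increasing v) → p ≡ q
Increasing-irrelevant []       []       = refl
Increasing-irrelevant [-]      [-]      = refl
Increasing-irrelevant (r ∷ rs) (s ∷ ss) = cong₂ _∷_ (ℕ.≤-irrelevant r s) (Increasing-irrelevant rs ss)

ferrers-≡ : ∀ {n} {F G : Ferrers n} → rows F ≡ rows G → F ≡ G
ferrers-≡ {F = ferrers v p} {ferrers .v q} refl = cong (ferrers v) (Increasing-irrelevant p q)

Increasing-tail : ∀ {n x} {v : Vec ℕ n} → Increasing (x ∷ v) → Increasing v
Increasing-tail [-]     = []
Increasing-tail (_ ∷ r) = r

Increasing-lower : ∀ {n x y} {v : Vec ℕ n} → x ≤ y → Increasing (y ∷ v) → Increasing (x ∷ v)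
Increasing-lower x≤y [-]       = [-]
Increasing-lower x≤y (y≤z ∷ r) = ℕ.≤-trans x≤y y≤z ∷ r

Increasing-0∷ : ∀ {n} {v : Vec ℕ n} → Increasing v → Increasing (0 ∷ v)
Increasing-0∷ {v = []}    _  = [-]
Increasing-0∷ {v = _ ∷ _} v↑ = z≤n ∷ v↑

-- Dom d k s φ: with a credit of d added to it, every partial sum of s is at
-- least that of k; the excesses over all non-empty prefixes add up to φ.
data Dom (d : ℕ) : ∀ {n} → Vec ℕ n → Vec ℕ n → ℕ → Set where
  []   : Dom d [] [] 0
  cons : ∀ {n x y d′ φ} {k s : Vec ℕ n} → x + d′ ≡ d + y → Dom d′ k s φ → Dom d (x ∷ k) (y ∷ s) (d′ + φ)

-- Operations on bare vectors: an entry can be put in front without any order condition, and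
-- monotonicity is tracked separately.
data Move {n} (v w : Vec ℕ n) : Set where
  shift : ∀ p p′ → p′ Fin.< p → 1 ≤ lookup v p → w ≡ (v [ p ]%= ℕ.pred) [ p′ ]%= suc → Move v w
  add   : ∀ p → w ≡ v [ p ]%= suc → Move v w

Move-∷ : ∀ {n x} {v w : Vec ℕ n} → Move v w → Move (x ∷ v) (x ∷ w)
Move-∷ (shift p p′ p′<p 1≤ refl) = shift (Fin.suc p) (Fin.suc p′) (s≤s p′<p) 1≤ refl
Move-∷ (add p refl)              = add (Fin.suc p) refl

Move⇒Operation : ∀ {n} {v w : Vec ℕ n} {v↑ : Increasing v} {w↑ : Increasing w} →
                 Move v w → Operation (ferrers v v↑) (ferrers w w↑)
Move⇒Operation (shift p p′ p′<p 1≤ eq) = shift (p , p′ , p′<p , 1≤ , eq)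
Move⇒Operation (add p eq)              = add (p , eq)

-- Raising an entry that lies below its target costs one unit of the credit passed on, which is
-- there to be spent.
credit : ∀ {x y d d′} → x < y → x + d′ ≡ d + y → ∃ λ e → d′ ≡ suc e × suc x + e ≡ d + y
credit {x} {y} {d} {zero} x<y eq = contradiction eq
  (ℕ.<⇒≢ (ℕ.<-≤-trans (subst (_< y) (sym (ℕ.+-identityʳ x)) x<y) (ℕ.m≤n+m y d)))
credit {x} {d′ = suc e} x<y eq = e , refl , trans (sym (ℕ.+-suc x e)) eq

-- A unit of credit is recovered by lowering the first entry of k that exceeds
-- the bound b by one or more: the entries before it equal b, hence are at most
-- those of s, so that no partial sum fails before the unit is recovered.
lower-entry : ∀ {n b d φ} {k s : Vec ℕ n} → Increasing (b ∷ k) → Increasing (b ∷ s) → Dom (suc d) k s φ →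
              (∃ λ φ′ → φ′ ≤ φ × Dom d k s φ′)
              ⊎ ∃ λ p → 1 ≤ lookup k p × Increasing (b ∷ (k [ p ]%= ℕ.pred))
                × ∃ λ φ′ → φ′ ≤ φ × Dom d (k [ p ]%= ℕ.pred) s φ′
lower-entry _ _ [] = inj₁ (0 , z≤n , [])
lower-entry {b = b} {d} (b≤z ∷ z∷k↑) (b≤y ∷ y∷s↑) (cons {x = z} {y} {d′} eq dom)
  with ℕ.m≤n⇒m<n∨m≡n b≤z
... | inj₁ (s≤s b≤z′) = inj₂ (Fin.zero , s≤s z≤n , b≤z′ ∷ Increasing-lower (ℕ.n≤1+n _) z∷k↑
                             , _ , ℕ.≤-refl , cons (ℕ.suc-injective eq) dom)
... | inj₂ refl with e , refl , eq′ ← credit {x = b} {suc y} {d} (s≤s b≤y) (trans eq (sym (ℕ.+-suc d y)))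
  with lower-entry z∷k↑ (Increasing-lower b≤y y∷s↑) dom
... | inj₁ (φ′ , φ′≤φ , dom′) =
  inj₁ (_ , ℕ.+-mono-≤ (ℕ.n≤1+n e) φ′≤φ , cons (ℕ.suc-injective (trans eq′ (ℕ.+-suc d y))) dom′)
... | inj₂ (p , 1≤ , k′↑ , φ′ , φ′≤φ , dom′) =
  inj₂ (Fin.suc p , 1≤ , ℕ.≤-refl ∷ k′↑ , _ , ℕ.+-mono-≤ (ℕ.n≤1+n e) φ′≤φ
       , cons (ℕ.suc-injective (trans eq′ (ℕ.+-suc d y))) dom′)

-- The unit of credit spent is recovered at a later entry, which gives a shift, or no later entry is
-- large enough and the move is an addition.
raise-head : ∀ {n x d φ} {k : Vec ℕ n} {s} → Increasing (suc x ∷ k) → Increasing (suc x ∷ s) → Dom d (x ∷ k) s φ →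
             ∃ λ k′ → Move (x ∷ k) k′ × Increasing (x ∷ k′) × ∃ λ φ′ → φ′ < φ × Dom d k′ s φ′
raise-head {x = x} k↑ (x<y ∷ y∷s↑) (cons eq dom) with e , refl , eq′ ← credit x<y eq
  with lower-entry k↑ (Increasing-lower x<y y∷s↑) dom
... | inj₁ (φ′ , φ′≤φ , dom′) =
  _ , add Fin.zero refl , ℕ.n≤1+n x ∷ k↑ , _ , s≤s (ℕ.+-monoʳ-≤ e φ′≤φ) , cons eq′ dom′
... | inj₂ (p , 1≤ , k′↑ , φ′ , φ′≤φ , dom′) =
  _ , shift (Fin.suc p) Fin.zero (s≤s z≤n) 1≤ refl , ℕ.n≤1+n x ∷ k′↑
  , _ , s≤s (ℕ.+-monoʳ-≤ e φ′≤φ) , cons eq′ dom′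

-- Only the last of a block of equal entries can be raised without breaking monotonicity; `s` stays
-- above `x` along the whole block.
raise-block : ∀ {n x d φ} {k : Vec ℕ n} {s} → Increasing (x ∷ k) → Increasing (suc x ∷ s) → Dom d (x ∷ k) s φ →
              ∃ λ k′ → Move (x ∷ k) k′ × Increasing (x ∷ k′) × ∃ λ φ′ → φ′ < φ × Dom d k′ s φ′
raise-block [-] s↑ dom = raise-head [-] s↑ dom
raise-block {k = _ ∷ _} (x≤z ∷ k↑) s↑@(x<y ∷ y∷s↑) dom@(cons eq dom′) with ℕ.m≤n⇒m<n∨m≡n x≤z
... | inj₁ x<z  = raise-head (x<z ∷ k↑) s↑ dom
... | inj₂ refl with k′ , move , k′↑ , φ′ , φ′<φ , dom″ ← raise-block k↑ (Increasing-lower x<y y∷s↑) dom′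
  = _ , Move-∷ move , ℕ.≤-refl ∷ k′↑ , _ , ℕ.+-monoʳ-< _ φ′<φ , cons eq dom″

advance : ∀ {n b φ} {k s : Vec ℕ n} → Increasing (b ∷ k) → Increasing (b ∷ s) → Dom 0 k s φ →
          k ≡ s ⊎ ∃ λ k′ → Move k k′ × Increasing (b ∷ k′) × ∃ λ φ′ → φ′ < φ × Dom 0 k′ s φ′
advance _ _ [] = inj₁ refl
advance (b≤x ∷ x∷k↑) (b≤y ∷ y∷s↑) (cons {x = x} {d′ = d′} refl dom) with d′
-- Credit left over after this entry means that the vectors first differ here.
... | suc e with k′ , move , k′↑ , result ←
      raise-block x∷k↑ (subst (suc x ≤_) (sym (ℕ.+-suc x e)) (s≤s (ℕ.m≤m+n x e)) ∷ y∷s↑) (cons refl dom)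
  = inj₂ (k′ , move , Increasing-lower b≤x k′↑ , result)
... | zero rewrite ℕ.+-identityʳ x with advance x∷k↑ y∷s↑ dom
... | inj₁ refl = inj₁ refl
... | inj₂ (k′ , move , k′↑ , φ′ , φ′<φ , dom′) =
  inj₂ (_ , Move-∷ move , b≤x ∷ k′↑ , φ′ , φ′<φ , cons (ℕ.+-identityʳ x) dom′)

-- Every move lowers the total excess φ, so the recursion ends.
Dom⇒Compatible : ∀ {n φ} {F G : Ferrers n} → Dom 0 (rows F) (rows G) φ → Compatible F G
Dom⇒Compatible dom = go (<-wellFounded _) dom
  where
  go : ∀ {n φ} {F G : Ferrers n} → Acc _<_ φ → Dom 0 (rows F) (rows G) φ → Compatible F G
  go {F = F} {G} (acc smaller) dom
    with advance (Increasing-0∷ (increasing F)) (Increasing-0∷ (increasing G)) dom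
  ... | inj₁ eq = subst (Compatible F) (ferrers-≡ eq) ε
  ... | inj₂ (k′ , move , k′↑ , φ′ , φ′<φ , dom′) =
    Move⇒Operation {w↑ = Increasing-tail k′↑} move ◅ go (smaller φ′<φ) dom′

[_] : Bool → ℕ
[ b ] = if b then 1 else 0

-- Orientations

≤-respʳ : ∀ {i j k : ℕ} → k ≡ j → i ≤ j → i ≤ k
≤-respʳ refl i≤j = i≤j

[]-< : ∀ {u v} → [ u ] < [ v ] → u ≡ false × v ≡ true
[]-< {false} {true} _         = refl , refl
[]-< {true}  {true} (s≤s ())

sum-mono-≤ : ∀ {n} {f g : Fin n → ℕ} → (∀ i → f i ≤ g i) → sum f ≤ sum g
sum-mono-≤ {zero}  f≤g = z≤n
sum-mono-≤ {suc n} f≤g = ℕ.+-mono-≤ (f≤g Fin.zero) (sum-mono-≤ (f≤g ∘ Fin.suc))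

-- Carries the effect of changing one edge over to the number of incoming edges.
sum-mono-≤-except : ∀ {n d e} {f g : Fin n → ℕ} i → (∀ j → j ≢ i → f j ≤ g j) →
                    d + f i ≤ e + g i → d + sum f ≤ e + sum g
sum-mono-≤-except {d = d} {e} {f} {g} Fin.zero f≤g fᵢ≤gᵢ = begin
  d + (f Fin.zero + sum (f ∘ Fin.suc)) ≡⟨ ℕ.+-assoc d _ _ ⟨
  d + f Fin.zero + sum (f ∘ Fin.suc)   ≤⟨ ℕ.+-mono-≤ fᵢ≤gᵢ (sum-mono-≤ (λ j → f≤g (Fin.suc j) λ ())) ⟩
  e + g Fin.zero + sum (g ∘ Fin.suc)   ≡⟨ ℕ.+-assoc e _ _ ⟩
  e + (g Fin.zero + sum (g ∘ Fin.suc)) ∎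
  where open ℕ.≤-Reasoning
sum-mono-≤-except {d = d} {e} {f} {g} (Fin.suc i) f≤g fᵢ≤gᵢ = begin
  d + (f Fin.zero + sum (f ∘ Fin.suc)) ≡⟨ x∙yz≈y∙xz d (f Fin.zero) (sum (f ∘ Fin.suc)) ⟩
  f Fin.zero + (d + sum (f ∘ Fin.suc)) ≤⟨ ℕ.+-mono-≤ (f≤g Fin.zero λ ())
    (sum-mono-≤-except i (λ j j≢i → f≤g (Fin.suc j) (j≢i ∘ Fin.suc-injective)) fᵢ≤gᵢ) ⟩
  g Fin.zero + (e + sum (g ∘ Fin.suc)) ≡⟨ x∙yz≈y∙xz (g Fin.zero) e (sum (g ∘ Fin.suc)) ⟩
  e + (g Fin.zero + sum (g ∘ Fin.suc)) ∎
  where open ℕ.≤-Reasoning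

sum-indicators≤ : ∀ {n} (f : Fin n → Bool) → sum (λ i → [ f i ]) ≤ n
sum-indicators≤ {zero}  f = z≤n
sum-indicators≤ {suc n} f with f Fin.zero
... | true  = s≤s (sum-indicators≤ (f ∘ Fin.suc))
... | false = ℕ.m≤n⇒m≤1+n (sum-indicators≤ (f ∘ Fin.suc))

sum-zero : ∀ n → sum {n} (λ _ → 0) ≡ 0
sum-zero zero    = refl
sum-zero (suc n) = sum-zero n

sum-<⇒∃< : ∀ {n} {f g : Fin n → ℕ} → sum f < sum g → ∃ λ i → f i < g i
sum-<⇒∃< {f = f} {g} f<g =
  let i , fᵢ≱gᵢ = Fin.¬∀⟶∃¬ _ (λ i → g i ≤ f i) (λ i → g i ℕ.≤? f i) (λ g≤f → ℕ.<⇒≱ f<g (sum-mono-≤ g≤f))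
  in i , ℕ.≰⇒> fᵢ≱gᵢ

Vec-sum : ∀ {n} (v : Vec ℕ n) → Vec.sum v ≡ sum (lookup v)
Vec-sum []      = refl
Vec-sum (x ∷ v) = cong (x +_) (Vec-sum v)

∣∣+complement : ∀ {n} (S : Subset n) → ∣ S ∣ + sum (λ i → [ not (lookup S i) ]) ≡ n
∣∣+complement []            = refl
∣∣+complement (inside ∷ S)  = cong suc (∣∣+complement S)
∣∣+complement (outside ∷ S) = trans (ℕ.+-suc ∣ S ∣ _) (cong suc (∣∣+complement S))

∣∷∣≤ : ∀ {n} s (S : Subset n) → ∣ s ∷ S ∣ ≤ suc ∣ S ∣
∣∷∣≤ inside  S = ℕ.≤-refl
∣∷∣≤ outside S = ℕ.n≤1+n _

lookup-receive : ∀ {k} (S : Subset k) v i → lookup (receive S v) i ≡ [ lookup S i ] + lookup v i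
lookup-receive (inside  ∷ S) (x ∷ v) Fin.zero    = refl
lookup-receive (outside ∷ S) (x ∷ v) Fin.zero    = refl
lookup-receive (_       ∷ S) (x ∷ v) (Fin.suc i) = lookup-receive S v i

-- An orientation of the edges between non-sink vertices: the edge ij points to
-- the bottom vertex j when O i j is true, and to the top vertex i otherwise.
Orientation : ℕ → ℕ → Set
Orientation m n = Fin m → Fin n → Bool

in-top : ∀ {m n} → Orientation m n → Fin m → ℕ
in-top O i = sum λ j → [ not (O i j) ]

in-bottom : ∀ {m n} → Orientation m n → Fin n → ℕ
in-bottom O j = sum λ i → [ O i j ]

Supports : ∀ {m n} → Orientation m n → Config m n → Set
Supports O (t , b) = (∀ i → in-top O i ≤ lookup t i) × (∀ j → in-bottom O j ≤ lookup b j)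

Supported : ∀ {m n} → Config m n → Set
Supported x = ∃ λ O → Supports O x

Supports-mono : ∀ {m n} {O : Orientation m n} {x y} → Supports O x →
                (∀ v → grains x v ≤ grains y v) → Supports O y
Supports-mono (tops , bottoms) x≤y =
  (λ i → ℕ.≤-trans (tops i) (x≤y (top i))) , (λ j → ℕ.≤-trans (bottoms j) (x≤y (bottom j)))

lookup-updateAt-suc : ∀ {n} (v : Vec ℕ n) i j → lookup v j ≤ lookup (v [ i ]%= suc) j
lookup-updateAt-suc v i j with j Fin.≟ i
... | yes refl = ℕ.≤-trans (ℕ.n≤1+n _) (ℕ.≤-reflexive (sym (Vec.lookup∘updateAt j v)))
... | no  j≢i  = ℕ.≤-reflexive (sym (Vec.lookup∘updateAt′ j i j≢i v))

grains-addGrain : ∀ {m n} v w (x : Config m n) → grains x w ≤ grains (addGrain v x) w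
grains-addGrain (top i)    (top i′)    (t , b) = lookup-updateAt-suc t i i′
grains-addGrain (top _)    (bottom _)  (t , b) = ℕ.≤-refl
grains-addGrain (bottom _) (top _)     (t , b) = ℕ.≤-refl
grains-addGrain (bottom j) (bottom j′) (t , b) = lookup-updateAt-suc b j j′

Supported-addGrain : ∀ {m n} v {x : Config m n} → Supported x → Supported (addGrain v x)
Supported-addGrain v {x} (O , supports) = O , Supports-mono {x = x} {addGrain v x} supports (λ w → grains-addGrain v w x)

m+n≡o⇒n≤k∸m : ∀ {m n o k} → m + n ≡ o → o ≤ k → n ≤ k ∸ m
m+n≡o⇒n≤k∸m {m} {n} refl m+n≤k = ℕ.≤-trans (ℕ.≤-reflexive (sym (ℕ.m+n∸m≡n m n))) (ℕ.∸-monoˡ-≤ m m+n≤k)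

Supported-topple : ∀ {m n} v S {x : Config m n} → Unstable x v → Supported x → Supported (topple v S x)
Supported-topple {n = n} (top i) S {t , b} unstable (O , tops , bottoms) = O′ , tops′ , bottoms′
  where
  O′ : Orientation _ _
  O′ i′ j = if does (i′ Fin.≟ i) then lookup S j else O i′ j
  tops′ : ∀ i′ → in-top O′ i′ ≤ lookup (t [ i ]%= (_∸ ∣ S ∣)) i′
  tops′ i′ with i′ Fin.≟ i
  ... | yes refl = ≤-respʳ (Vec.lookup∘updateAt i t) (m+n≡o⇒n≤k∸m {∣ S ∣} (∣∣+complement S) unstable)
  ... | no  i′≢i = ≤-respʳ (Vec.lookup∘updateAt′ i′ i i′≢i t) (tops i′)
  bottoms′ : ∀ j → in-bottom O′ j ≤ lookup (receive S b) j
  bottoms′ j = ≤-respʳ (lookup-receive S b j) (ℕ.≤-trans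
    (sum-mono-≤-except {d = 0} i elsewhere here) (ℕ.+-monoʳ-≤ [ lookup S j ] (bottoms j)))
    where
    elsewhere : ∀ i′ → i′ ≢ i → [ O′ i′ j ] ≤ [ O i′ j ]
    elsewhere i′ i′≢i rewrite dec-false (i′ Fin.≟ i) i′≢i = ℕ.≤-refl
    here : [ O′ i j ] ≤ [ lookup S j ] + [ O i j ]
    here rewrite dec-true (i Fin.≟ i) refl = ℕ.m≤m+n _ _
Supported-topple {m} (bottom j) (s ∷ S) {t , b} unstable (O , tops , bottoms) = O′ , tops′ , bottoms′
  where
  O′ : Orientation _ _
  O′ i j′ = if does (j′ Fin.≟ j) then not (lookup S i) else O i j′
  bottoms′ : ∀ j′ → in-bottom O′ j′ ≤ lookup (b [ j ]%= (_∸ ∣ s ∷ S ∣)) j′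
  bottoms′ j′ with j′ Fin.≟ j
  -- The degree includes the sink, so even if a grain goes there, one grain remains for each top
  -- that receives none.
  ... | yes refl = ≤-respʳ (Vec.lookup∘updateAt j b) (ℕ.≤-trans
    (m+n≡o⇒n≤k∸m {suc ∣ S ∣} (cong suc (∣∣+complement S)) unstable) (ℕ.∸-monoʳ-≤ _ (∣∷∣≤ s S)))
  ... | no j′≢j = ≤-respʳ (Vec.lookup∘updateAt′ j′ j j′≢j b) (bottoms j′)
  tops′ : ∀ i → in-top O′ i ≤ lookup (receive S t) i
  tops′ i = ≤-respʳ (lookup-receive S t i) (ℕ.≤-trans
    (sum-mono-≤-except {d = 0} j elsewhere here) (ℕ.+-monoʳ-≤ [ lookup S i ] (tops i)))
    where
    elsewhere : ∀ j′ → j′ ≢ j → [ not (O′ i j′) ] ≤ [ not (O i j′) ]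
    elsewhere j′ j′≢j rewrite dec-false (j′ Fin.≟ j) j′≢j = ℕ.≤-refl
    here : [ not (O′ i j) ] ≤ [ lookup S i ] + [ not (O i j) ]
    here rewrite dec-true (j Fin.≟ j) refl with lookup S i
    ... | true  = s≤s z≤n
    ... | false = z≤n

Supported-full-bottoms : ∀ {m n} {x : Config m n} → (∀ j → m ≤ lookup (proj₂ x) j) → Supported x
Supported-full-bottoms {n = n} m≤b = (λ _ _ → true)
  , (λ i → ℕ.≤-trans (ℕ.≤-reflexive (sum-zero n)) z≤n)
  , (λ j → ℕ.≤-trans (sum-indicators≤ _) (m≤b j))

redirect : ∀ {m n} → Fin m → Fin n → Bool → Orientation m n → Orientation m n
redirect i j v O i′ j′ = if does (i′ Fin.≟ i) then (if does (j′ Fin.≟ j) then v else O i′ j′) else O i′ j′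

redirect-here : ∀ {m n} i j v (O : Orientation m n) → redirect i j v O i j ≡ v
redirect-here i j v O rewrite dec-true (i Fin.≟ i) refl | dec-true (j Fin.≟ j) refl = refl

redirect-≢ˡ : ∀ {m n i i′} j v (O : Orientation m n) → i′ ≢ i → ∀ j′ → redirect i j v O i′ j′ ≡ O i′ j′
redirect-≢ˡ {i = i} {i′} j v O i′≢i j′ rewrite dec-false (i′ Fin.≟ i) i′≢i = refl

redirect-≢ʳ : ∀ {m n j j′} i v (O : Orientation m n) → j′ ≢ j → ∀ i′ → redirect i j v O i′ j′ ≡ O i′ j′
redirect-≢ʳ {j = j} {j′} i v O j′≢j i′ with i′ Fin.≟ i
... | no _ = refl
... | yes _ rewrite dec-false (j′ Fin.≟ j) j′≢j = refl

in-top-redirect : ∀ {m n} i j v (O : Orientation m n) {d e} → d + [ not v ] ≤ e + [ not (O i j) ] →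
                  d + in-top (redirect i j v O) i ≤ e + in-top O i
in-top-redirect i j v O bound = sum-mono-≤-except j
  (λ j′ j′≢j → ℕ.≤-reflexive (cong (λ o → [ not o ]) (redirect-≢ʳ i v O j′≢j i)))
  (subst (λ o → _ + [ not o ] ≤ _) (sym (redirect-here i j v O)) bound)

in-bottom-redirect : ∀ {m n} i j v (O : Orientation m n) {d e} → d + [ v ] ≤ e + [ O i j ] →
                     d + in-bottom (redirect i j v O) j ≤ e + in-bottom O j
in-bottom-redirect i j v O bound = sum-mono-≤-except i
  (λ i′ i′≢i → ℕ.≤-reflexive (cong [_] (redirect-≢ˡ j v O i′≢i j)))
  (subst (λ o → _ + [ o ] ≤ _) (sym (redirect-here i j v O)) bound)

in-top-≢ : ∀ {m n i i′} j v (O : Orientation m n) → i′ ≢ i → in-top (redirect i j v O) i′ ≡ in-top O i′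
in-top-≢ j v O i′≢i = sum-cong-≗ (λ j′ → cong (λ o → [ not o ]) (redirect-≢ˡ j v O i′≢i j′))

in-bottom-≢ : ∀ {m n j j′} i v (O : Orientation m n) → j′ ≢ j → in-bottom (redirect i j v O) j′ ≡ in-bottom O j′
in-bottom-≢ i v O j′≢j = sum-cong-≗ (λ i′ → cong [_] (redirect-≢ʳ i v O j′≢j i′))

-- If a unit can be moved from s_p to s_p′, but not for O itself, then p has
-- more incoming edges than p′, and for some i the edges ip and ip′ point to p
-- and to i; both are reversed.
Supports-shift : ∀ {m n} {t : Vec ℕ m} {s : Vec ℕ n} {O} {p p′} → p′ ≢ p → Supports O (t , s) →
                 lookup s p′ < in-bottom O p →
                 Supported (t , (s [ p ]%= ℕ.pred) [ p′ ]%= suc)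
Supports-shift {t = t} {s} {O} {p} {p′} p′≢p (tops , bottoms) sₚ′<inₚ
  with i , Oᵢₚ′<Oᵢₚ ← sum-<⇒∃< (ℕ.≤-<-trans (bottoms p′) sₚ′<inₚ)
  = O₂ , tops₂ , bottoms₂
  where
  Oᵢₚ′≡false : O i p′ ≡ false
  Oᵢₚ′≡false = proj₁ ([]-< Oᵢₚ′<Oᵢₚ)
  Oᵢₚ≡true : O i p ≡ true
  Oᵢₚ≡true = proj₂ ([]-< {O i p′} Oᵢₚ′<Oᵢₚ)
  O₁ O₂ : Orientation _ _
  O₁ = redirect i p false O
  O₂ = redirect i p′ true O₁
  O₁ᵢₚ′≡false : O₁ i p′ ≡ false
  O₁ᵢₚ′≡false = trans (redirect-≢ʳ i false O p′≢p i) Oᵢₚ′≡false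
  tops₂ : ∀ i′ → in-top O₂ i′ ≤ lookup t i′
  tops₂ i′ = case i′ Fin.≟ i of λ where
    (yes refl) → ℕ.≤-trans (ℕ.≤-pred (ℕ.≤-trans
      (in-top-redirect i p′ true O₁ {1} {0} (subst (λ o → 1 ≤ [ not o ]) (sym O₁ᵢₚ′≡false) ℕ.≤-refl))
      (in-top-redirect i p false O {0} {1} (s≤s z≤n)))) (tops i)
    (no i′≢i) → ℕ.≤-trans (ℕ.≤-reflexive
      (trans (in-top-≢ p′ true O₁ i′≢i) (in-top-≢ p false O i′≢i))) (tops i′)
  bottoms₁ : ∀ j → in-bottom O₁ j ≤ lookup (s [ p ]%= ℕ.pred) j
  bottoms₁ j = case j Fin.≟ p of λ where
    (yes refl) → ≤-respʳ (Vec.lookup∘updateAt p s) (ℕ.≤-pred (ℕ.≤-trans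
      (in-bottom-redirect i p false O {1} {0} (subst (λ o → 1 ≤ [ o ]) (sym Oᵢₚ≡true) ℕ.≤-refl))
      (ℕ.≤-trans (bottoms p) (ℕ.≤-reflexive (sym (ℕ.suc-pred (lookup s p) {{ℕ.>-nonZero (ℕ.≤-trans (s≤s z≤n) (ℕ.≤-trans sₚ′<inₚ (bottoms p)))}}))))))
    (no j≢p) → ≤-respʳ (Vec.lookup∘updateAt′ j p j≢p s)
      (ℕ.≤-trans (ℕ.≤-reflexive (in-bottom-≢ i false O j≢p)) (bottoms j))
  bottoms₂ : ∀ j → in-bottom O₂ j ≤ lookup ((s [ p ]%= ℕ.pred) [ p′ ]%= suc) j
  bottoms₂ j = case j Fin.≟ p′ of λ where
    (yes refl) → ≤-respʳ (Vec.lookup∘updateAt p′ (s [ p ]%= ℕ.pred)) (ℕ.≤-trans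
      (in-bottom-redirect i p′ true O₁ {0} {1} (s≤s z≤n)) (s≤s (bottoms₁ p′)))
    (no j≢p′) → ≤-respʳ (Vec.lookup∘updateAt′ j p′ j≢p′ (s [ p ]%= ℕ.pred))
      (ℕ.≤-trans (ℕ.≤-reflexive (in-bottom-≢ i true O₁ j≢p′)) (bottoms₁ j))

Increasing-lookup : ∀ {n} {v : Vec ℕ n} → Increasing v → ∀ {i j} → i Fin.≤ j → lookup v i ≤ lookup v j
Increasing-lookup {v = x ∷ v} v↑ {Fin.zero}  {Fin.zero}  _ = ℕ.≤-refl
Increasing-lookup {v = x ∷ y ∷ v} (x≤y ∷ v↑) {Fin.zero} {Fin.suc j} _ =
  ℕ.≤-trans x≤y (Increasing-lookup v↑ {Fin.zero} {j} z≤n)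
Increasing-lookup {v = x ∷ v} v↑ {Fin.suc i} {Fin.suc j} (s≤s i≤j) = Increasing-lookup (Increasing-tail v↑) i≤j

Supported-operation : ∀ {m n} {t : Vec ℕ m} {F G : Ferrers n} → Operation F G →
                      Supported (t , rows F) → Supported (t , rows G)
Supported-operation {t = t} {F} {G} (add (p , eq)) supported =
  subst (λ s → Supported (t , s)) (sym eq) (Supported-addGrain (bottom p) {t , rows F} supported)
Supported-operation {t = t} {F} {G} (shift (p , p′ , p′<p , 1≤sₚ , eq)) (O , supports@(tops , bottoms))
  = subst (λ s → Supported (t , s)) (sym eq) supported
  where
  s = rows F
  p′≢p : p′ ≢ p
  p′≢p p′≡p = ℕ.<⇒≢ p′<p (cong toℕ p′≡p)
  -- Legality of the shift: the result is increasing, so the raised row is at most the lowered one.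
  sₚ′<pred-sₚ : lookup s p′ < ℕ.pred (lookup s p)
  sₚ′<pred-sₚ = subst₂ _≤_
    (trans (cong (λ v → lookup v p′) eq) (trans (Vec.lookup∘updateAt p′ (s [ p ]%= ℕ.pred))
      (cong suc (Vec.lookup∘updateAt′ p′ p p′≢p s))))
    (trans (cong (λ v → lookup v p) eq) (trans (Vec.lookup∘updateAt′ p p′ (p′≢p ∘ sym) (s [ p ]%= ℕ.pred))
      (Vec.lookup∘updateAt p s)))
    (Increasing-lookup (increasing G) (ℕ.<⇒≤ p′<p))
  supported : Supported (t , (s [ p ]%= ℕ.pred) [ p′ ]%= suc)
  -- The orientation has to change only if the lowered row no longer covers its incoming edges.
  supported with ℕ.pred (lookup s p) ℕ.<? in-bottom O p
  ... | yes pred-sₚ<inₚ = Supports-shift {t = t} {s} p′≢p supports (ℕ.<-trans sₚ′<pred-sₚ pred-sₚ<inₚ)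
  ... | no  pred-sₚ≮inₚ = O , tops , λ j → ℕ.≤-trans (bottoms′ j) (lookup-updateAt-suc (s [ p ]%= ℕ.pred) p′ j)
    where
    bottoms′ : ∀ j → in-bottom O j ≤ lookup (s [ p ]%= ℕ.pred) j
    bottoms′ j with j Fin.≟ p
    ... | yes refl = ≤-respʳ (Vec.lookup∘updateAt p s) (ℕ.≮⇒≥ pred-sₚ≮inₚ)
    ... | no j≢p   = ≤-respʳ (Vec.lookup∘updateAt′ j p j≢p s) (bottoms j)

Supported-Compatible : ∀ {m n} {t : Vec ℕ m} {F G : Ferrers n} → Compatible F G →
                       Supported (t , rows F) → Supported (t , rows G)
Supported-Compatible ε          supported = supported
Supported-Compatible {t = t} (op ◅ ops) supported =
  Supported-Compatible {t = t} ops (Supported-operation {t = t} op supported)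

-- Supported configurations and the partial sums of the vector k

#below-sum : ∀ {m} (t : Vec ℕ m) x → #below t x ≡ sum (λ i → [ lookup t i <ᵇ x ])
#below-sum []      x = refl
#below-sum (y ∷ t) x with y <ᵇ x
... | true  = cong suc (#below-sum t x)
... | false = #below-sum t x

lookup-k-vector : ∀ {m n} (t : Vec ℕ m) (j : Fin n) → lookup (k-vector t) j ≡ sum (λ i → [ lookup t i <ᵇ suc (toℕ j) ])
lookup-k-vector t j = trans (Vec.lookup∘tabulate _ j) (#below-sum t (suc (toℕ j)))

#above≤ : ∀ n x → sum {n} (λ j → [ not (x <ᵇ suc (toℕ j)) ]) ≤ x
#above≤ zero    x       = z≤n
#above≤ (suc n) zero    = ℕ.≤-reflexive (sum-zero n)
#above≤ (suc n) (suc x) = s≤s (#above≤ n x)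

-- Top `i` takes its edges from the first t_i bottom vertices and gives away the rest; row `j` then
-- receives exactly k_j edges.
Supported-k-vector : ∀ {m n} (t : Vec ℕ m) → Supported (t , k-vector {n = n} t)
Supported-k-vector {n = n} t = (λ i j → lookup t i <ᵇ suc (toℕ j))
  , (λ i → #above≤ n (lookup t i))
  , (λ j → ℕ.≤-reflexive (sym (lookup-k-vector t j)))

prefix : ℕ → ∀ {n} → (Fin n → ℕ) → ℕ
prefix (suc b) {suc n} f = f Fin.zero + prefix b (f ∘ Fin.suc)
prefix _       _         = 0

prefix-mono-≤ : ∀ b {n} {f g : Fin n → ℕ} → (∀ i → f i ≤ g i) → prefix b f ≤ prefix b g
prefix-mono-≤ zero              f≤g = z≤n
prefix-mono-≤ (suc b) {zero}    f≤g = z≤n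
prefix-mono-≤ (suc b) {suc n}   f≤g = ℕ.+-mono-≤ (f≤g Fin.zero) (prefix-mono-≤ b (f≤g ∘ Fin.suc))

prefix-sum : ∀ b {m n} (f : Fin m → Fin n → ℕ) →
             prefix b (λ j → sum (λ i → f i j)) ≡ sum (λ i → prefix b (f i))
prefix-sum zero    {m}         f = sym (sum-zero m)
prefix-sum (suc b) {m} {zero}  f = sym (sum-zero m)
prefix-sum (suc b) {m} {suc n} f = trans
  (cong (sum (λ i → f i Fin.zero) +_) (prefix-sum b (λ i j → f i (Fin.suc j))))
  (sym (∑-distrib-+ (λ i → f i Fin.zero) (λ i → prefix b (f i ∘ Fin.suc))))

-- Among the 0-1 vectors with at most x zeros, the one with the x zeros in
-- front has the smallest partial sums; e is the induction slack.
prefix-threshold≤ : ∀ b {n} x e (o : Fin n → Bool) → sum (λ j → [ not (o j) ]) ≤ x + e →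
                    prefix b {n} (λ j → [ x <ᵇ suc (toℕ j) ]) ≤ e + prefix b (λ j → [ o j ])
prefix-threshold≤ zero            x e o _ = z≤n
prefix-threshold≤ (suc b) {zero}  x e o _ = z≤n
prefix-threshold≤ (suc b) {suc n} x e o bound with o Fin.zero
prefix-threshold≤ (suc b) {suc n} zero e o bound | true =
  ≤-respʳ (ℕ.+-suc e _) (s≤s (prefix-threshold≤ b zero e (o ∘ Fin.suc) bound))
prefix-threshold≤ (suc b) {suc n} (suc x) e o bound | true =
  ≤-respʳ (ℕ.+-suc e _)
    (prefix-threshold≤ b x (suc e) (o ∘ Fin.suc) (≤-respʳ (ℕ.+-suc x e) bound))
prefix-threshold≤ (suc b) {suc n} zero (suc e) o (s≤s bound) | false =
  s≤s (prefix-threshold≤ b zero e (o ∘ Fin.suc) bound)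
prefix-threshold≤ (suc b) {suc n} (suc x) e o (s≤s bound) | false =
  prefix-threshold≤ b x e (o ∘ Fin.suc) bound

-- Edges into the first `b` bottom vertices are counted top by top. Top `i` keeps at most t_i edges,
-- and sends fewest into these rows when the kept ones come first.
Supported⇒prefix-≤ : ∀ {m n} {t : Vec ℕ m} {s : Vec ℕ n} → Supported (t , s) →
                     ∀ b → prefix b (lookup (k-vector {n = n} t)) ≤ prefix b (lookup s)
Supported⇒prefix-≤ {m} {n} {t} {s} (O , tops , bottoms) b = begin
  prefix b (lookup (k-vector {n = n} t))
    ≤⟨ prefix-mono-≤ b (λ j → ℕ.≤-reflexive (lookup-k-vector t j)) ⟩
  prefix b (λ j → sum (λ i → [ lookup t i <ᵇ suc (toℕ j) ]))
    ≡⟨ prefix-sum b (λ i j → [ lookup t i <ᵇ suc (toℕ j) ]) ⟩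
  sum (λ i → prefix b (λ j → [ lookup t i <ᵇ suc (toℕ j) ]))
    ≤⟨ sum-mono-≤ (λ i → prefix-threshold≤ b (lookup t i) 0 (O i) (≤-respʳ (ℕ.+-identityʳ _) (tops i))) ⟩
  sum (λ i → prefix b (λ j → [ O i j ]))
    ≡⟨ prefix-sum b (λ i j → [ O i j ]) ⟨
  prefix b (in-bottom O)
    ≤⟨ prefix-mono-≤ b bottoms ⟩
  prefix b (lookup s) ∎
  where open ℕ.≤-Reasoning

prefix-≤⇒Dom : ∀ {n d} (k s : Vec ℕ n) → (∀ b → prefix b (lookup k) ≤ d + prefix b (lookup s)) → ∃ (Dom d k s)
prefix-≤⇒Dom []      []      _     = 0 , []
prefix-≤⇒Dom {d = d} (x ∷ k) (y ∷ s) bound =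
  let φ , dom = prefix-≤⇒Dom k s (λ b → ℕ.+-cancelˡ-≤ x _ _ (begin
        x + prefix b (lookup k)                  ≤⟨ bound (suc b) ⟩
        d + (y + prefix b (lookup s))            ≡⟨ ℕ.+-assoc d y _ ⟨
        d + y + prefix b (lookup s)              ≡⟨ cong (_+ prefix b (lookup s)) x+d′≡d+y ⟨
        x + (d + y ∸ x) + prefix b (lookup s)    ≡⟨ ℕ.+-assoc x _ _ ⟩
        x + (d + y ∸ x + prefix b (lookup s))    ∎))
  in _ , cons x+d′≡d+y dom
  where
  open ℕ.≤-Reasoning
  -- The prefix of length one shows that the subtraction does not truncate.
  x+d′≡d+y : x + (d + y ∸ x) ≡ d + y
  x+d′≡d+y = ℕ.m+[n∸m]≡n (subst₂ _≤_ (ℕ.+-identityʳ x) (cong (d +_) (ℕ.+-identityʳ y)) (bound 1))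

-- Paths of the chain

Vec-≡⊎< : ∀ {n} (v w : Vec ℕ n) → (∀ i → lookup v i ≤ lookup w i) → v ≡ w ⊎ ∃ λ i → lookup v i < lookup w i
Vec-≡⊎< []      []      _   = inj₁ refl
Vec-≡⊎< (x ∷ v) (y ∷ w) v≤w with ℕ.m≤n⇒m<n∨m≡n (v≤w Fin.zero) | Vec-≡⊎< v w (v≤w ∘ Fin.suc)
... | inj₁ x<y  | _              = inj₂ (Fin.zero , x<y)
... | inj₂ refl | inj₁ refl      = inj₁ refl
... | inj₂ _    | inj₂ (i , v<w) = inj₂ (Fin.suc i , v<w)

Config-≡⊎< : ∀ {m n} (x y : Config m n) → (∀ v → grains x v ≤ grains y v) →
             x ≡ y ⊎ ∃ λ v → grains x v < grains y v
Config-≡⊎< (t , b) (t′ , b′) x≤y with Vec-≡⊎< t t′ (x≤y ∘ top) | Vec-≡⊎< b b′ (x≤y ∘ bottom)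
... | inj₂ (i , t<t′) | _               = inj₂ (top i , t<t′)
... | inj₁ refl       | inj₂ (j , b<b′) = inj₂ (bottom j , b<b′)
... | inj₁ refl       | inj₁ refl       = inj₁ refl

sum-%=suc : ∀ {n} (v : Vec ℕ n) i → Vec.sum (v [ i ]%= suc) ≡ suc (Vec.sum v)
sum-%=suc (x ∷ v) Fin.zero    = refl
sum-%=suc (x ∷ v) (Fin.suc i) = trans (cong (x +_) (sum-%=suc v i)) (ℕ.+-suc x _)

total-addGrain : ∀ {m n} v (x : Config m n) → total (addGrain v x) ≡ suc (total x)
total-addGrain (top i)    (t , b) = cong (_+ Vec.sum b) (sum-%=suc t i)
total-addGrain (bottom j) (t , b) = trans (cong (Vec.sum t +_) (sum-%=suc b j)) (ℕ.+-suc _ _)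

sum-%=∸ : ∀ {n} (v : Vec ℕ n) i {k} → k ≤ lookup v i → k + Vec.sum (v [ i ]%= (_∸ k)) ≡ Vec.sum v
sum-%=∸ (x ∷ v) Fin.zero {k} k≤x = trans (sym (ℕ.+-assoc k _ _)) (cong (_+ Vec.sum v) (ℕ.m+[n∸m]≡n k≤x))
sum-%=∸ (x ∷ v) (Fin.suc i) {k} k≤vᵢ = trans (x∙yz≈y∙xz k x _) (cong (x +_) (sum-%=∸ v i k≤vᵢ))

sum-receive : ∀ {n} (S : Subset n) v → Vec.sum (receive S v) ≡ ∣ S ∣ + Vec.sum v
sum-receive []            []      = refl
sum-receive (inside  ∷ S) (x ∷ v) = cong suc (trans (cong (x +_) (sum-receive S v)) (x∙yz≈y∙xz x ∣ S ∣ _))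
sum-receive (outside ∷ S) (x ∷ v) = trans (cong (x +_) (sum-receive S v)) (x∙yz≈y∙xz x ∣ S ∣ _)

∣∣≤∣∷∣ : ∀ {n} s (S : Subset n) → ∣ S ∣ ≤ ∣ s ∷ S ∣
∣∣≤∣∷∣ inside  S = ℕ.n≤1+n _
∣∣≤∣∷∣ outside S = ℕ.≤-refl

total-topple : ∀ {m n} v S (x : Config m n) → Unstable x v → total (topple v S x) ≤ total x
total-topple (top i) S (t , b) unstable = ℕ.≤-reflexive (begin
  Vec.sum (t [ i ]%= (_∸ ∣ S ∣)) + Vec.sum (receive S b)   ≡⟨ cong (Vec.sum (t [ i ]%= (_∸ ∣ S ∣)) +_) (sum-receive S b) ⟩
  Vec.sum (t [ i ]%= (_∸ ∣ S ∣)) + (∣ S ∣ + Vec.sum b)     ≡⟨ x∙yz≈y∙xz (Vec.sum (t [ i ]%= (_∸ ∣ S ∣))) ∣ S ∣ (Vec.sum b) ⟩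
  ∣ S ∣ + (Vec.sum (t [ i ]%= (_∸ ∣ S ∣)) + Vec.sum b)     ≡⟨ ℕ.+-assoc ∣ S ∣ _ _ ⟨
  ∣ S ∣ + Vec.sum (t [ i ]%= (_∸ ∣ S ∣)) + Vec.sum b       ≡⟨ cong (_+ Vec.sum b) (sum-%=∸ t i (ℕ.≤-trans (∣p∣≤n S) unstable)) ⟩
  Vec.sum t + Vec.sum b                                    ∎)
  where open ≡-Reasoning
total-topple (bottom j) (s ∷ S) (t , b) unstable = begin
  Vec.sum (receive S t) + b′          ≡⟨ cong (_+ b′) (sum-receive S t) ⟩
  ∣ S ∣ + Vec.sum t + b′              ≤⟨ ℕ.+-monoˡ-≤ b′ (ℕ.+-monoˡ-≤ (Vec.sum t) (∣∣≤∣∷∣ s S)) ⟩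
  ∣ s ∷ S ∣ + Vec.sum t + b′          ≡⟨ ℕ.+-assoc ∣ s ∷ S ∣ (Vec.sum t) b′ ⟩
  ∣ s ∷ S ∣ + (Vec.sum t + b′)        ≡⟨ x∙yz≈y∙xz ∣ s ∷ S ∣ (Vec.sum t) b′ ⟩
  Vec.sum t + (∣ s ∷ S ∣ + b′)        ≡⟨ cong (Vec.sum t +_) (sum-%=∸ b j (ℕ.≤-trans (∣p∣≤n (s ∷ S)) unstable)) ⟩
  Vec.sum t + Vec.sum b               ∎
  where open ℕ.≤-Reasoning
        b′ = Vec.sum (b [ j ]%= (_∸ ∣ s ∷ S ∣))

sum≤length*bound : ∀ {n k} (v : Vec ℕ n) → (∀ i → lookup v i ≤ k) → Vec.sum v ≤ n * k
sum≤length*bound []      _   = z≤n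
sum≤length*bound (x ∷ v) v≤k = ℕ.+-mono-≤ (v≤k Fin.zero) (sum≤length*bound v (v≤k ∘ Fin.suc))

Stable⇒total≤ : ∀ {m n} {x : Config m n} → Stable x → total x ≤ m * n + n * m
Stable⇒total≤ {x = t , b} stable = ℕ.+-mono-≤
  (sum≤length*bound t (λ i → ℕ.<⇒≤ (stable (top i)))) (sum≤length*bound b (λ j → ℕ.≤-pred (stable (bottom j))))

total-mono-≤ : ∀ {m n} {x y : Config m n} → (∀ v → grains x v ≤ grains y v) → total x ≤ total y
total-mono-≤ {x = t , b} {t′ , b′} x≤y = subst₂ _≤_
  (sym (cong₂ _+_ (Vec-sum t) (Vec-sum b))) (sym (cong₂ _+_ (Vec-sum t′) (Vec-sum b′)))
  (ℕ.+-mono-≤ (sum-mono-≤ (x≤y ∘ top)) (sum-mono-≤ (x≤y ∘ bottom)))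

distance-up : ∀ {c n} → c < n → ∣ suc c - n ∣ < ∣ c - n ∣
distance-up {zero}  {suc n} _         = ℕ.≤-refl
distance-up {suc c} {suc n} (s≤s c<n) = distance-up c<n

distance-down : ∀ {c n} → n ≤ c → ∣ c - n ∣ < ∣ suc c - n ∣
distance-down {c} {zero} _ = s≤s (ℕ.≤-reflexive (ℕ.∣-∣-identityʳ c))
distance-down {suc c} {suc n} (s≤s n≤c) = distance-down n≤c

sum-map-%=< : ∀ {k} (φ f : ℕ → ℕ) (v : Vec ℕ k) i → φ (f (lookup v i)) < φ (lookup v i) →
              Vec.sum (Vec.map φ (v [ i ]%= f)) < Vec.sum (Vec.map φ v)
sum-map-%=< φ f (x ∷ v) Fin.zero    φfx<φx = ℕ.+-monoˡ-< _ φfx<φx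
sum-map-%=< φ f (x ∷ v) (Fin.suc i) φfv<φv = ℕ.+-monoʳ-< (φ x) (sum-map-%=< φ f v i φfv<φv)

receive-empty : ∀ {k} (v : Vec ℕ k) → receive empty v ≡ v
receive-empty []      = refl
receive-empty (x ∷ v) = cong (x ∷_) (receive-empty v)

addGrain-≤ : ∀ {m n} v {x y : Config m n} → (∀ w → grains x w ≤ grains y w) → grains x v < grains y v →
             ∀ w → grains (addGrain v x) w ≤ grains y w
addGrain-≤ v {x} {y} x≤y xᵥ<yᵥ w = go v w xᵥ<yᵥ (x≤y w)
  where
  go : ∀ v w → grains x v < grains y v → grains x w ≤ grains y w → grains (addGrain v x) w ≤ grains y w
  go (top i) (top i′) x<y x≤y with i′ Fin.≟ i
  ... | yes refl = subst (_≤ _) (sym (Vec.lookup∘updateAt i (proj₁ x))) x<y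
  ... | no  i′≢i = subst (_≤ _) (sym (Vec.lookup∘updateAt′ i′ i i′≢i (proj₁ x))) x≤y
  go (bottom j) (bottom j′) x<y x≤y with j′ Fin.≟ j
  ... | yes refl = subst (_≤ _) (sym (Vec.lookup∘updateAt j (proj₂ x))) x<y
  ... | no  j′≢j = subst (_≤ _) (sym (Vec.lookup∘updateAt′ j′ j j′≢j (proj₂ x))) x≤y
  go (top i) (bottom j) _ x≤y = x≤y
  go (bottom j) (top i) _ x≤y = x≤y

module Paths {m n : ℕ} (0<n : 0 < n) (rule : TopplingRule m n) where

  open Steps rule
  open TopplingRule rule using (next)

  -- Topplings create no grains, and a grain is added only to a stable configuration; the outer
  -- `suc` accounts for it.
  total-bounded : ∀ {x y} → total x ≤ suc (m * n + n * m) → x ⟶ y → total y ≤ suc (m * n + n * m)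
  total-bounded {x} x≤M x⟶y with next x
  total-bounded {x} x≤M (adds v)    | inj₁ stable         =
    ℕ.≤-trans (ℕ.≤-reflexive (total-addGrain v x)) (s≤s (Stable⇒total≤ {x = x} stable))
  total-bounded {x} x≤M (topples S) | inj₂ (v , unstable) = ℕ.≤-trans (total-topple v S x unstable) x≤M

  Supported-closed : ∀ {x y} → Supported x → x ⟶ y → Supported y
  Supported-closed {x} supported x⟶y with next x
  Supported-closed {x} supported (adds v)    | inj₁ _              = Supported-addGrain v {x} supported
  Supported-closed {x} supported (topples S) | inj₂ (v , unstable) = Supported-topple v S {x} unstable supported

  add-step : ∀ {x} v → Stable x → x ⟶ addGrain v x
  add-step {x} v stable with next x
  ... | inj₁ _              = adds v
  ... | inj₂ (w , unstable) = contradiction (stable w) (ℕ.≤⇒≯ unstable)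

  -- The rule picks the vertex to topple, so a prescribed one is certain to be picked when no other
  -- is unstable.
  topple-step : ∀ {x} v S → Unstable x v → (∀ w → Unstable x w → w ≡ v) → x ⟶ topple v S x
  topple-step {x} v S unstable only-v with next x
  ... | inj₁ stable = contradiction (stable v) (ℕ.≤⇒≯ unstable)
  ... | inj₂ (w , unstable′) with refl ← only-v w unstable′ = topples S

  -- Everything below a stable configuration is stable, so the missing grains can be added one after
  -- another; their number bounds the recursion.
  fill : ∀ {x y} → Stable y → (∀ v → grains x v ≤ grains y v) → Star _⟶_ x y
  fill {x} {y} y-stable x≤y = go (total y) x≤y (ℕ.m≤m+n _ _)
    where
    go : ∀ k {x} → (∀ v → grains x v ≤ grains y v) → total y ≤ k + total x → Star _⟶_ x y
    go k {x} x≤y y≤k+x with Config-≡⊎< x y x≤y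
    ... | inj₁ refl = ε
    ... | inj₂ (v , xᵥ<yᵥ) = grow k y≤k+x
      where
      x′≤y = addGrain-≤ v {x} {y} x≤y xᵥ<yᵥ
      grow : ∀ k → total y ≤ k + total x → Star _⟶_ x y
      grow zero    y≤x = contradiction
        (ℕ.≤-trans (ℕ.≤-reflexive (sym (total-addGrain v x))) (total-mono-≤ {x = addGrain v x} {y} x′≤y)) (ℕ.≤⇒≯ y≤x)
      grow (suc k) y≤1+k+x = add-step v (λ w → ℕ.≤-<-trans (x≤y w) (y-stable w)) ◅
        go k x′≤y (ℕ.≤-trans y≤1+k+x (ℕ.≤-reflexive
          (trans (sym (ℕ.+-suc k (total x))) (cong (k +_) (sym (total-addGrain v x))))))

  -- Both measures vanish exactly at the drained values. A top vertex must first
  -- hold n grains before it can be emptied, whence the jump of empty-tops at 0.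
  empty-tops full-bottoms : ℕ → ℕ
  empty-tops zero    = 0
  empty-tops (suc c) = suc ∣ suc c - n ∣
  full-bottoms c = ∣ c - m ∣

  drained : Config m n
  drained = replicate m 0 , replicate n m

  -- A lexicographic descent: a step that changes the tops may do anything to the bottoms.
  Progress : Vec ℕ m → Vec ℕ n → Set
  Progress t b = (t , b) ≡ drained
    ⊎ (∃₂ λ t′ b′ → (t , b) ⟶ (t′ , b′)
         × Vec.sum (Vec.map empty-tops t′) < Vec.sum (Vec.map empty-tops t))
    ⊎ ∃ λ b′ → (t , b) ⟶ (t , b′)
         × Vec.sum (Vec.map full-bottoms b′) < Vec.sum (Vec.map full-bottoms b)

  empty-tops-add : ∀ {c} → 0 < c → c < n → empty-tops (suc c) < empty-tops c
  empty-tops-add {suc c} _ c<n = s≤s (distance-up c<n)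

  -- With exactly `n` grains all of them are sent and the top is emptied; with more, a single one is
  -- sent, which comes closer to `n`.
  drain-top : ∀ {c} → n ≤ c → ∃ λ (S : Subset n) → empty-tops (c ∸ ∣ S ∣) < empty-tops c
  drain-top {c} n≤c with ℕ.m≤n⇒m<n∨m≡n n≤c
  ... | inj₂ refl = full , subst₂ (λ c d → empty-tops c < empty-tops d)
    (sym (trans (cong (n ∸_) (∣⊤∣≡n n)) (ℕ.n∸n≡0 n))) (ℕ.suc-pred n {{ℕ.>-nonZero 0<n}}) (s≤s z≤n)
  drain-top {suc c} _ | inj₁ (s≤s n≤c) = ⁅ Fin.fromℕ< 0<n ⁆
    , subst (λ k → empty-tops (suc c ∸ k) < empty-tops (suc c)) (sym (∣⁅x⁆∣≡1 (Fin.fromℕ< 0<n))) (closer c n≤c)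
    where
    closer : ∀ c → n ≤ c → empty-tops c < empty-tops (suc c)
    closer zero    n≤0 = contradiction (ℕ.≤-trans 0<n n≤0) λ ()
    closer (suc c) n≤c = s≤s (distance-down n≤c)

  -- The one grain sent goes into the sink, so the tops are untouched.
  drain-bottom : ∀ {c} → suc m ≤ c → full-bottoms (c ∸ ∣ inside ∷ empty {m} ∣) < full-bottoms c
  drain-bottom {suc c} (s≤s m≤c) =
    subst (λ k → full-bottoms (c ∸ k) < full-bottoms (suc c)) (sym (∣⊥∣≡0 m)) (distance-down m≤c)

  progress : ∀ t b → Progress t b
  progress t b with next (t , b)
  ... | inj₂ (top i , unstable) with S , closer ← drain-top unstable =
    inj₂ (inj₁ (_ , _ , topples S , sum-map-%=< empty-tops (_∸ ∣ S ∣) t i closer))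
  ... | inj₂ (bottom j , unstable) = inj₂ (inj₂ (_ , subst (λ t′ → Outcome (t , b) _ (t′ , b [ j ]%= (_∸ ∣ inside ∷ empty {m} ∣)))
                                         (receive-empty t) (topples (inside ∷ empty))
    , sum-map-%=< full-bottoms (_∸ ∣ inside ∷ empty {m} ∣) b j (drain-bottom unstable)))
  ... | inj₁ stable with Vec-≡⊎< (replicate m 0) t (λ i → subst (_≤ lookup t i) (sym (Vec.lookup-replicate i 0)) z≤n)
                       | Vec-≡⊎< b (replicate n m) (λ j → subst (lookup b j ≤_) (sym (Vec.lookup-replicate j m)) (ℕ.≤-pred (stable (bottom j))))
  ... | inj₁ refl | inj₁ refl = inj₁ refl
  ... | inj₂ (i , 0<tᵢ) | _ = inj₂ (inj₁ (_ , _ , adds (top i) , sum-map-%=< empty-tops suc t i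
    (empty-tops-add (subst (_< lookup t i) (Vec.lookup-replicate i 0) 0<tᵢ) (stable (top i)))))
  ... | inj₁ _ | inj₂ (j , bⱼ<m) = inj₂ (inj₂ (_ , adds (bottom j) , sum-map-%=< full-bottoms suc b j
    (distance-up (subst (lookup b j <_) (Vec.lookup-replicate j m) bⱼ<m))))

  drain : ∀ x → Star _⟶_ x drained
  drain (t , b) = go t b (<-wellFounded _) (<-wellFounded _)
    where
    continue : ∀ {t b} → Progress t b →
      (∀ t′ b′ → Vec.sum (Vec.map empty-tops t′) < Vec.sum (Vec.map empty-tops t) → Star _⟶_ (t′ , b′) drained) →
      (∀ b′ → Vec.sum (Vec.map full-bottoms b′) < Vec.sum (Vec.map full-bottoms b) → Star _⟶_ (t , b′) drained) →
      Star _⟶_ (t , b) drained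
    continue (inj₁ refl)                           _        _           = ε
    continue (inj₂ (inj₁ (t′ , b′ , step , less))) continueᵗ _          = step ◅ continueᵗ t′ b′ less
    continue (inj₂ (inj₂ (b′ , step , less)))      _         continueᵇ  = step ◅ continueᵇ b′ less
    go : ∀ t b → Acc _<_ (Vec.sum (Vec.map empty-tops t)) → Acc _<_ (Vec.sum (Vec.map full-bottoms b)) →
         Star _⟶_ (t , b) drained
    go t b tops-acc@(acc tops) (acc bottoms) = continue (progress t b)
      (λ t′ b′ less → go t′ b′ (tops less) (<-wellFounded _)) (λ b′ less → go t b′ tops-acc (bottoms less))

  module _ {c : Config m n} (c-stable : Stable c) {O : Orientation m n} (supports : Supports O c) where

    -- Bottom vertices J, J+1, … still hold their initial m grains; the others
    -- have been toppled along their outgoing edges.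
    record Processed (J : ℕ) (x : Config m n) : Set where
      field
        tops : ∀ i → lookup (proj₁ x) i ≤ sum (λ j → if does (toℕ j ℕ.<? J) then [ not (O i j) ] else 0)
        done : ∀ j → toℕ j < J → lookup (proj₂ x) j ≤ lookup (proj₂ c) j
        todo : ∀ j → J ≤ toℕ j → lookup (proj₂ x) j ≡ m

    open Processed

    Processed-drained : Processed 0 drained
    Processed-drained .tops i = ℕ.≤-trans (ℕ.≤-reflexive (Vec.lookup-replicate i 0)) z≤n
    Processed-drained .done _ ()
    Processed-drained .todo j _ = Vec.lookup-replicate j m

    Processed-tops : ∀ {J x} → Processed J x → ∀ i → lookup (proj₁ x) i ≤ lookup (proj₁ c) i
    Processed-tops {J} P i = ℕ.≤-trans (P .tops i) (ℕ.≤-trans (sum-mono-≤ bound) (proj₁ supports i))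
      where
      bound : ∀ j → (if does (toℕ j ℕ.<? J) then [ not (O i j) ] else 0) ≤ [ not (O i j) ]
      bound j with does (toℕ j ℕ.<? J)
      ... | true  = ℕ.≤-refl
      ... | false = z≤n

    Processed-stable : ∀ {J x} → Processed J x → Stable x
    Processed-stable P (top i) = ℕ.≤-<-trans (Processed-tops P i) (c-stable (top i))
    Processed-stable {J} P (bottom j) with toℕ j ℕ.<? J
    ... | yes j<J = ℕ.≤-<-trans (P .done j j<J) (c-stable (bottom j))
    ... | no  j≮J = s≤s (ℕ.≤-reflexive (P .todo j (ℕ.≮⇒≥ j≮J)))

    process : ∀ {J x} (j : Fin n) → toℕ j ≡ J → Processed J x → ∃ λ y → Star _⟶_ x y × Processed (suc J) y
    process {J} {x@(t , b)} j refl P = z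
      , add-step (bottom j) (Processed-stable P) ◅ topple-step (bottom j) S unstable only-j ◅ ε
      , record { tops = tops′ ; done = done′ ; todo = todo′ }
      where
      outgoing : Subset m
      outgoing = tabulate (λ i → not (O i j))
      S = inside ∷ outgoing
      y z : Config m n
      y = addGrain (bottom j) x
      z = topple (bottom j) S y
      yⱼ≡1+m : lookup (proj₂ y) j ≡ suc m
      yⱼ≡1+m = trans (Vec.lookup∘updateAt j b) (cong suc (P .todo j ℕ.≤-refl))
      z-≢ : ∀ {j′} → j′ ≢ j → lookup (proj₂ z) j′ ≡ lookup b j′
      z-≢ {j′} j′≢j = trans (Vec.lookup∘updateAt′ j′ j j′≢j (proj₂ y)) (Vec.lookup∘updateAt′ j′ j j′≢j b)
      unstable : Unstable y (bottom j)
      unstable = ℕ.≤-reflexive (sym yⱼ≡1+m)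
      only-j : ∀ w → Unstable y w → w ≡ bottom j
      only-j (top i) uᵢ = contradiction (Processed-stable P (top i)) (ℕ.≤⇒≯ uᵢ)
      only-j (bottom j′) uⱼ′ with j′ Fin.≟ j
      ... | yes refl = refl
      ... | no  j′≢j = contradiction (subst (_< suc m) (sym (Vec.lookup∘updateAt′ j′ j j′≢j b))
                         (Processed-stable P (bottom j′))) (ℕ.≤⇒≯ uⱼ′)
      tops′ : ∀ i → lookup (proj₁ z) i ≤ sum (λ j′ → if does (toℕ j′ ℕ.<? suc J) then [ not (O i j′) ] else 0)
      tops′ i = begin
        lookup (proj₁ z) i                   ≡⟨ lookup-receive outgoing t i ⟩
        [ lookup outgoing i ] + lookup t i   ≡⟨ cong (λ o → [ o ] + lookup t i) (Vec.lookup∘tabulate _ i) ⟩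
        [ not (O i j) ] + lookup t i         ≤⟨ ℕ.+-monoʳ-≤ [ not (O i j) ] (P .tops i) ⟩
        [ not (O i j) ] + sum before         ≤⟨ sum-mono-≤-except {d = [ not (O i j) ]} {0} j (λ j′ _ → elsewhere j′) here ⟩
        sum after                            ∎
        where
        open ℕ.≤-Reasoning
        before after : Fin n → ℕ
        before j′ = if does (toℕ j′ ℕ.<? J) then [ not (O i j′) ] else 0
        after j′  = if does (toℕ j′ ℕ.<? suc J) then [ not (O i j′) ] else 0
        elsewhere : ∀ j′ → before j′ ≤ after j′
        elsewhere j′ = case toℕ j′ ℕ.<? J of λ where
          (yes j′<J) → ℕ.≤-reflexive (trans
            (cong (if_then [ not (O i j′) ] else 0) (dec-true (toℕ j′ ℕ.<? J) j′<J))
            (sym (cong (if_then [ not (O i j′) ] else 0) (dec-true (toℕ j′ ℕ.<? suc J) (ℕ.m<n⇒m<1+n j′<J)))))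
          (no j′≮J) → ℕ.≤-trans (ℕ.≤-reflexive
            (cong (if_then [ not (O i j′) ] else 0) (dec-false (toℕ j′ ℕ.<? J) j′≮J))) z≤n
        here : [ not (O i j) ] + before j ≤ after j
        here = ℕ.≤-reflexive (trans
          (cong (λ o → [ not (O i j) ] + (if o then [ not (O i j) ] else 0)) (dec-false (toℕ j ℕ.<? J) (ℕ.n≮n J)))
          (trans (ℕ.+-identityʳ _)
            (sym (cong (if_then [ not (O i j) ] else 0) (dec-true (toℕ j ℕ.<? suc J) (ℕ.n<1+n J))))))
      -- Of the m + 1 grains one goes to the sink and one along each outgoing edge, which leaves one
      -- for each incoming edge.
      remaining : m ∸ ∣ outgoing ∣ ≡ in-bottom O j
      remaining = trans
        (trans (cong (_∸ ∣ outgoing ∣) (sym (∣∣+complement outgoing))) (ℕ.m+n∸m≡n ∣ outgoing ∣ _))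
        (sum-cong-≗ (λ i → cong [_] (trans (cong not (Vec.lookup∘tabulate _ i)) (not-involutive (O i j)))))
      done′ : ∀ j′ → toℕ j′ < suc J → lookup (proj₂ z) j′ ≤ lookup (proj₂ c) j′
      done′ j′ (s≤s j′≤j) = case j′ Fin.≟ j of λ where
        (yes refl) → ℕ.≤-trans (ℕ.≤-reflexive (trans (Vec.lookup∘updateAt j (proj₂ y))
          (trans (cong (_∸ ∣ S ∣) yⱼ≡1+m) remaining))) (proj₂ supports j)
        (no j′≢j) → ℕ.≤-trans (ℕ.≤-reflexive (z-≢ j′≢j))
          (P .done j′ (ℕ.≤∧≢⇒< j′≤j (j′≢j ∘ Fin.toℕ-injective)))
      todo′ : ∀ j′ → suc J ≤ toℕ j′ → lookup (proj₂ z) j′ ≡ m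
      todo′ j′ J<j′ = trans (z-≢ λ { refl → ℕ.n≮n J J<j′ }) (P .todo j′ (ℕ.<⇒≤ J<j′))

    process-all : ∀ k {J x} → J + k ≡ n → Processed J x → ∃ λ y → Star _⟶_ x y × Processed n y
    process-all zero    {J} {x} J+0≡n P =
      x , ε , subst (λ J → Processed J x) (trans (sym (ℕ.+-identityʳ J)) J+0≡n) P
    process-all (suc k) {J} J+1+k≡n P =
      let J<n = ℕ.≤-trans (ℕ.m≤m+n (suc J) k) (ℕ.≤-reflexive (trans (sym (ℕ.+-suc J k)) J+1+k≡n))
          y , x→y , P′ = process (Fin.fromℕ< J<n) (Fin.toℕ-fromℕ< J<n) P
          z , y→z , P″ = process-all k (trans (sym (ℕ.+-suc J k)) J+1+k≡n) P′
      in z , x→y ◅◅ y→z , P″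

    reach : ∀ x → Star _⟶_ x c
    reach x with y , drained→y , P ← process-all n refl Processed-drained = drain x ◅◅ drained→y ◅◅ fill c-stable λ where
      (top i)    → Processed-tops P i
      (bottom j) → P .done j (Fin.toℕ<n j)

  reach-Supported : ∀ {x} → Stable x → ∃ λ y → Star _⟶_ x y × Supported y
  reach-Supported {x = t , b} stable = (t , replicate n m)
    , fill target-stable (λ where
        (top i)    → ℕ.≤-refl
        (bottom j) → ℕ.≤-trans (ℕ.≤-pred (stable (bottom j))) (ℕ.≤-reflexive (sym (Vec.lookup-replicate j m))))
    , Supported-full-bottoms {x = t , replicate n m} (λ j → ℕ.≤-reflexive (sym (Vec.lookup-replicate j m)))
    where
    target-stable : Stable (t , replicate n m)
    target-stable (top i)    = stable (top i)
    target-stable (bottom j) = s≤s (ℕ.≤-reflexive (Vec.lookup-replicate j m))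

-- Conjugation of diagrams

#below-all : ∀ {m x} (v : Vec ℕ m) → (∀ i → lookup v i < x) → #below v x ≡ m
#below-all []      _   = refl
#below-all {x = x} (y ∷ v) v<x rewrite dec-true (y ℕ.<? x) (v<x Fin.zero) = cong suc (#below-all v (v<x ∘ Fin.suc))

<-#below : ∀ {m x} {v : Vec ℕ m} → Increasing v → ∀ i → lookup v i < x → toℕ i < #below v x
<-#below {x = x} {y ∷ v} v↑ i vᵢ<x
  rewrite dec-true (y ℕ.<? x) (ℕ.≤-<-trans (Increasing-lookup v↑ {Fin.zero} {i} z≤n) vᵢ<x) with i
... | Fin.zero   = s≤s z≤n
... | Fin.suc i′ = s≤s (<-#below (Increasing-tail v↑) i′ vᵢ<x)

#below-none : ∀ {m x y} {v : Vec ℕ m} → Increasing (y ∷ v) → x ≤ y → #below (y ∷ v) x ≡ 0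
#below-none {x = x} {y} [-] x≤y rewrite dec-false (y ℕ.<? x) (ℕ.≤⇒≯ x≤y) = refl
#below-none {x = x} {y} {_ ∷ _} (y≤z ∷ v↑) x≤y rewrite dec-false (y ℕ.<? x) (ℕ.≤⇒≯ x≤y) =
  #below-none v↑ (ℕ.≤-trans x≤y y≤z)

#below-≤ : ∀ {m x} {v : Vec ℕ m} → Increasing v → ∀ i → x ≤ lookup v i → #below v x ≤ toℕ i
#below-≤ {v = _ ∷ _} v↑ Fin.zero x≤y = ℕ.≤-reflexive (#below-none v↑ x≤y)
#below-≤ {x = x} {y ∷ v} v↑ (Fin.suc i) x≤vᵢ with does (y ℕ.<? x)
... | true  = s≤s (#below-≤ (Increasing-tail v↑) i x≤vᵢ)
... | false = ℕ.m≤n⇒m≤1+n (#below-≤ (Increasing-tail v↑) i x≤vᵢ)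

sum-<ᵇ : ∀ {n x} → x ≤ n → sum {n} (λ j → [ toℕ j <ᵇ x ]) ≡ x
sum-<ᵇ {n} z≤n       = sum-zero n
sum-<ᵇ     (s≤s x≤n) = cong suc (sum-<ᵇ x≤n)

sum-≥ᵇ : ∀ {n x} → x ≤ n → sum {n} (λ j → [ x <ᵇ suc (toℕ j) ]) + x ≡ n
sum-≥ᵇ {zero}  z≤n       = refl
sum-≥ᵇ {suc n} z≤n       = cong suc (sum-≥ᵇ {n} z≤n)
sum-≥ᵇ {suc n} {suc x} (s≤s x≤n) = trans (ℕ.+-suc _ x) (cong suc (sum-≥ᵇ x≤n))

-- Since `v` is increasing, at most `i` of its entries are `≤ j` exactly when entry `i` exceeds `j`
-- (this is `swap`); there are v_i such `j`, all within range.
lookup-k-vector² : ∀ {m n} {v : Vec ℕ m} → Increasing v → ∀ i → lookup v i ≤ n →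
                   lookup (k-vector {n = m} (k-vector {n = n} v)) i ≡ lookup v i
lookup-k-vector² {m} {n} {v} v↑ i vᵢ≤n = begin
  lookup (k-vector {n = m} (k-vector {n = n} v)) i                  ≡⟨ lookup-k-vector (k-vector {n = n} v) i ⟩
  sum (λ j → [ lookup (k-vector {n = n} v) j <ᵇ suc (toℕ i) ])      ≡⟨ sum-cong-≗ (cong [_] ∘ swap) ⟩
  sum {n} (λ j → [ toℕ j <ᵇ lookup v i ])                           ≡⟨ sum-<ᵇ vᵢ≤n ⟩
  lookup v i                                                        ∎
  where
  open ≡-Reasoning
  swap : ∀ j → (lookup (k-vector {n = n} v) j <ᵇ suc (toℕ i)) ≡ (toℕ j <ᵇ lookup v i)
  swap j rewrite Vec.lookup∘tabulate {n = n} (λ j → #below v (suc (toℕ j))) j with toℕ j ℕ.<? lookup v i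
  ... | yes j<vᵢ = trans (dec-true (#below v (suc (toℕ j)) ℕ.<? suc (toℕ i)) (s≤s (#below-≤ v↑ i j<vᵢ)))
                         (sym (dec-true (toℕ j ℕ.<? lookup v i) j<vᵢ))
  ... | no  j≮vᵢ = trans (dec-false (#below v (suc (toℕ j)) ℕ.<? suc (toℕ i))
                            (ℕ.≤⇒≯ (<-#below v↑ i (s≤s (ℕ.≮⇒≥ j≮vᵢ)))))
                         (sym (dec-false (toℕ j ℕ.<? lookup v i) j≮vᵢ))

Vec-ext : ∀ {n} {v w : Vec ℕ n} → (∀ i → lookup v i ≡ lookup w i) → v ≡ w
Vec-ext {v = v} {w} eq = trans (sym (Vec.tabulate∘lookup v)) (trans (Vec.tabulate-cong eq) (Vec.tabulate∘lookup w))

k-vector-involutive : ∀ {m n} {v : Vec ℕ m} → Increasing v → (∀ i → lookup v i ≤ n) →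
                      k-vector (k-vector {n = n} v) ≡ v
k-vector-involutive v↑ v≤n = Vec-ext (λ i → lookup-k-vector² v↑ i (v≤n i))

-- In the m by n rectangle, `t` counts the cells on one side of a staircase and k those on the
-- other.
sum-k-vector : ∀ {m n} (t : Vec ℕ m) → (∀ i → lookup t i ≤ n) →
               Vec.sum t + Vec.sum (k-vector {n = n} t) ≡ m * n
sum-k-vector {m} {n} t t≤n = begin
  Vec.sum t + Vec.sum (k-vector {n = n} t)                             ≡⟨ ℕ.+-comm (Vec.sum t) _ ⟩
  Vec.sum (k-vector {n = n} t) + Vec.sum t                             ≡⟨ cong₂ _+_ (Vec-sum (k-vector {n = n} t)) (Vec-sum t) ⟩
  sum (lookup (k-vector {n = n} t)) + sum (lookup t)                   ≡⟨ cong (_+ sum (lookup t)) (sum-cong-≗ (lookup-k-vector {n = n} t)) ⟩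
  sum {n} (λ j → sum (λ i → [ lookup t i <ᵇ suc (toℕ j) ])) + sum (lookup t)
    ≡⟨ cong (_+ sum (lookup t)) (∑-comm {n} {m} (λ j i → [ lookup t i <ᵇ suc (toℕ j) ])) ⟩
  sum (λ i → sum {n} (λ j → [ lookup t i <ᵇ suc (toℕ j) ])) + sum (lookup t)
    ≡⟨ ∑-distrib-+ (λ i → sum {n} (λ j → [ lookup t i <ᵇ suc (toℕ j) ])) (lookup t) ⟨
  sum (λ i → sum {n} (λ j → [ lookup t i <ᵇ suc (toℕ j) ]) + lookup t i) ≡⟨ sum-cong-≗ (λ i → sum-≥ᵇ (t≤n i)) ⟩
  sum {m} (λ _ → n)                                                    ≡⟨ sum-const m ⟩
  m * n                                                                ∎
  where
  open ≡-Reasoning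
  sum-const : ∀ m → sum {m} (λ _ → n) ≡ m * n
  sum-const zero    = refl
  sum-const (suc m) = cong (n +_) (sum-const m)

last≡lookup : ∀ {n} (v : Vec ℕ (suc n)) → last v ≡ lookup v (Fin.fromℕ n)
last≡lookup (x ∷ [])    = refl
last≡lookup (x ∷ y ∷ v) = last≡lookup (y ∷ v)

lookup≤columns : ∀ {n} (F : Ferrers n) i → lookup (rows F) i ≤ columns F
lookup≤columns {suc n} F i = ℕ.≤-trans (Increasing-lookup (increasing F) (Fin.≤fromℕ i))
  (ℕ.≤-reflexive (sym (last≡lookup (rows F))))

columns-≤ : ∀ {n m} (F : Ferrers n) → (∀ i → lookup (rows F) i ≤ m) → columns F ≤ m
columns-≤ {zero}  F _   = z≤n
columns-≤ {suc n} F F≤m = ℕ.≤-trans (ℕ.≤-reflexive (last≡lookup (rows F))) (F≤m _)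

-- The last row counts the tops with fewer than `n` grains, which are all of them.
columns-k-vector : ∀ {m n} → 0 < n → (t : Vec ℕ m) → (∀ i → lookup t i < n) →
                   columns (ferrers (k-vector {n = n} t) (k-vector-increasing t)) ≡ m
columns-k-vector {n = suc n} _ t t<n = begin
  last (k-vector {n = suc n} t)                    ≡⟨ last≡lookup (k-vector {n = suc n} t) ⟩
  lookup (k-vector {n = suc n} t) (Fin.fromℕ n)    ≡⟨ Vec.lookup∘tabulate {n = suc n} (λ j → #below t (suc (toℕ j))) (Fin.fromℕ n) ⟩
  #below t (suc (toℕ (Fin.fromℕ n)))               ≡⟨ cong (λ x → #below t (suc x)) (Fin.toℕ-fromℕ n) ⟩
  #below t (suc n)                                 ≡⟨ #below-all t t<n ⟩
  _                                                ∎
  where open ≡-Reasoning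

-- The last row has all `m` cells, so it is never among the rows counted.
k-vector-< : ∀ {m n} → 0 < n → (F : Ferrers n) → columns F ≡ m → ∀ i → lookup (k-vector {n = m} (rows F)) i < n
k-vector-< {m} {suc n} _ F refl i = s≤s (ℕ.≤-trans (ℕ.≤-reflexive (Vec.lookup∘tabulate {n = m} (λ j → #below (rows F) (suc (toℕ j))) i))
  (ℕ.≤-trans (#below-≤ (increasing F) (Fin.fromℕ n) (ℕ.≤-trans (Fin.toℕ<n i) (ℕ.≤-reflexive (last≡lookup (rows F)))))
             (ℕ.≤-reflexive (Fin.toℕ-fromℕ n))))

area-operations : ∀ {n} {F G : Ferrers n} (ops : Operations F G) → area G ≡ area F + #adds ops
area-operations {F = F} ε = sym (ℕ.+-identityʳ (area F))
area-operations {F = F} (_◅_ {j = G} (shift (p , p′ , _ , 1≤ , eq)) ops) = trans (area-operations ops) (cong (_+ #adds ops)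
  (trans (cong Vec.sum eq) (trans (sum-%=suc (rows F [ p ]%= ℕ.pred) p′) (sum-%=∸ (rows F) p 1≤))))
area-operations {F = F} (_◅_ {j = G} (add (p , eq)) ops) = trans (area-operations ops)
  (trans (cong (_+ #adds ops) (trans (cong Vec.sum eq) (sum-%=suc (rows F) p))) (sym (ℕ.+-suc (area F) (#adds ops))))

-- Level, area and the bijection

open import Data.Integer.Base as ℤ using (+_)

+-cancelˡ-minus : ∀ a b c → + (a + b) ℤ.- + (a + c) ≡ + b ℤ.- + c
+-cancelˡ-minus a b c = trans (ℤ.m-n≡m⊖n (a + b) (a + c)) (trans (ℤ.+-cancelˡ-⊖ a b c) (sym (ℤ.m-n≡m⊖n b c)))

SortedConfig-≡ : ∀ {m n} {c d : SortedConfig m n} → proj₁ c ≡ proj₁ d → c ≡ d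
SortedConfig-≡ {c = (t , b) , t↑ , b↑} {_ , t↑′ , b↑′} refl =
  cong ((t , b) ,_) (cong₂ _,_ (Increasing-irrelevant t↑ t↑′) (Increasing-irrelevant b↑ b↑′))

level≡area-difference : ∀ {m n} (c : SortedConfig m n) → Stable (proj₁ c) →
                        level (proj₁ c) ≡ + area (proj₂ (Ψ c)) ℤ.- + area (proj₁ (Ψ c))
level≡area-difference {m} {n} c@((t , b) , _) stable = trans
  (cong (λ mn → + (Vec.sum t + Vec.sum b) ℤ.- + mn) (sym (sum-k-vector {n = n} t (ℕ.<⇒≤ ∘ stable ∘ top))))
  (+-cancelˡ-minus (Vec.sum t) (Vec.sum b) (Vec.sum (k-vector {n = n} t)))

level≡#adds : ∀ {m n} (c : SortedConfig m n) → Stable (proj₁ c) →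
              (ops : Operations (proj₁ (Ψ c)) (proj₂ (Ψ c))) → level (proj₁ c) ≡ + #adds ops
level≡#adds c stable ops = begin
  level (proj₁ c)                               ≡⟨ level≡area-difference c stable ⟩
  + area G ℤ.- + area F                         ≡⟨ cong₂ (λ x y → + x ℤ.- + y) (area-operations ops) (sym (ℕ.+-identityʳ (area F))) ⟩
  + (area F + #adds ops) ℤ.- + (area F + 0)     ≡⟨ +-cancelˡ-minus (area F) (#adds ops) 0 ⟩
  + #adds ops ℤ.- + 0                           ≡⟨ ℤ.+-identityʳ (+ #adds ops) ⟩
  + #adds ops                                   ∎
  where
  open ≡-Reasoning
  F = proj₁ (Ψ c)
  G = proj₂ (Ψ c)

module Bijection {a ℓ₁ ℓ₂ : Level} (K : ArchimedeanOrderedField a ℓ₁ ℓ₂)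
                 (p : ArchimedeanOrderedField.Carrier K)
                 (0<p : ArchimedeanOrderedField._<ᴷ_ K (ArchimedeanOrderedField.0# K) p)
                 (p<1 : ArchimedeanOrderedField._<ᴷ_ K p (ArchimedeanOrderedField.1# K))
                 (m n : ℕ) (0<n : 0 < n) (rule : TopplingRule m n) where

  open Recurrence K p 0<p p<1 0<n rule
  open Paths 0<n rule

  SR : SortedConfig m n → Set (a ⊔ ℓ₂)
  SR c = StochasticallyRecurrent K p rule (proj₁ c)

  -- Transience refutes the absence of an orientation without producing one. The double negation
  -- suffices, because the inequalities of partial sums drawn from it are decidable.
  SR⇒¬¬Supported : ∀ {c} → StochasticallyRecurrent K p rule c → ¬ ¬ Supported c
  SR⇒¬¬Supported {c} (stable , often) unsupported with y , path , supported ← reach-Supported stable =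
    transient {c} {Supported} Supported-closed unsupported path supported often

  Supported⇒SR : ∀ {c} → Stable c → Supported c → StochasticallyRecurrent K p rule c
  Supported⇒SR {c} stable (O , supports) = stable ,
    recurrent {c} (suc (m * n + n * m)) total-bounded (ℕ.m≤n⇒m≤1+n (Stable⇒total≤ {x = c} stable)) (reach stable supports)

  SR⇒CompatiblePair : ∀ c → SR c → CompatiblePair m (Ψ c)
  SR⇒CompatiblePair ((t , b) , t↑ , b↑) sr@(stable , _)
    = columns-k-vector 0<n t (stable ∘ top)
    , columns-≤ (ferrers b b↑) (ℕ.≤-pred ∘ stable ∘ bottom)
    , Dom⇒Compatible (proj₂ (prefix-≤⇒Dom (k-vector t) b λ r →
        decidable-stable (_ ℕ.≤? _) λ ≰ → SR⇒¬¬Supported sr λ supported → ≰ (Supported⇒prefix-≤ {t = t} {b} supported r)))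

  CompatiblePair⇒SR : ∀ {F F′} → CompatiblePair m (F , F′) → ∃ λ c → SR c × Ψ c ≡ (F , F′)
  CompatiblePair⇒SR {F} {F′} (columns≡m , columns≤m , compatible) = c , Supported⇒SR stable supported , Ψc≡
    where
    t : Vec ℕ m
    t = k-vector (rows F)
    c : SortedConfig m n
    c = (t , rows F′) , k-vector-increasing (rows F) , increasing F′
    stable : Stable (proj₁ c)
    stable (top i)    = k-vector-< 0<n F columns≡m i
    stable (bottom j) = s≤s (ℕ.≤-trans (lookup≤columns F′ j) columns≤m)
    k-vector-t : k-vector t ≡ rows F
    k-vector-t = k-vector-involutive (increasing F)
      (λ j → ℕ.≤-trans (lookup≤columns F j) (ℕ.≤-reflexive columns≡m))
    supported : Supported (proj₁ c)
    supported = Supported-Compatible {t = t} compatible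
      (subst (λ s → Supported (t , s)) k-vector-t (Supported-k-vector t))
    Ψc≡ : Ψ c ≡ (F , F′)
    Ψc≡ = cong₂ _,_ (ferrers-≡ k-vector-t) refl

  Ψ-SR : Σ _ SR → Σ _ (CompatiblePair m)
  Ψ-SR = map {P = SR} {Q = CompatiblePair m} Ψ (λ {c} → SR⇒CompatiblePair c)

  -- Only first components are compared, since one pair of diagrams may be linked by many sequences
  -- of operations. The tops are recovered from k by the involution.
  Ψ-injective : Injective (_≡_ on proj₁) (_≡_ on proj₁) Ψ-SR
  Ψ-injective {((t , b) , t↑ , b↑) , stable , _} {((t′ , b′) , t↑′ , b↑′) , stable′ , _} Ψ≡ =
    SortedConfig-≡ (cong₂ _,_ t≡t′ (cong (rows ∘ proj₂) Ψ≡))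
    where
    t≡t′ : t ≡ t′
    t≡t′ = trans (sym (k-vector-involutive t↑ (ℕ.<⇒≤ ∘ stable ∘ top)))
      (trans (cong (k-vector ∘ rows ∘ proj₁) Ψ≡) (k-vector-involutive t↑′ (ℕ.<⇒≤ ∘ stable′ ∘ top)))

  Ψ-surjective : Surjective (_≡_ on proj₁) (_≡_ on proj₁) Ψ-SR
  Ψ-surjective (_ , pair) =
    let c , sr , Ψc≡ = CompatiblePair⇒SR pair in (c , sr) , λ z≡c → trans (cong Ψ z≡c) Ψc≡

theorem3p2 :
    ∀ {a ℓ₁ ℓ₂} (K : ArchimedeanOrderedField a ℓ₁ ℓ₂) →
    let open ArchimedeanOrderedField K in
    (p : Carrier) → 0# <ᴷ p → p <ᴷ 1# →
    (m n : ℕ) → 1 ≤ n → (rule : TopplingRule m n) →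
    let SR : SortedConfig m n → Set (a ⊔ ℓ₂)
        SR c = StochasticallyRecurrent K p rule (proj₁ c)
    in
    (Σ[ maps ∈ (∀ c → SR c → CompatiblePair m (Ψ c)) ]
      Bijective (_≡_ on proj₁) (_≡_ on proj₁) (map {P = SR} {Q = CompatiblePair m} Ψ (λ {c} → maps c)))
    ×
    (∀ c → SR c →
      level (proj₁ c) ≡ + area (proj₂ (Ψ c)) ℤ.- + area (proj₁ (Ψ c))
      ×
      (∀ (ops : Operations (proj₁ (Ψ c)) (proj₂ (Ψ c))) →
        level (proj₁ c) ≡ + #adds ops))
theorem3p2 K p 0<p p<1 m n 1≤n rule =
    (SR⇒CompatiblePair , (λ {x} {y} → Ψ-injective {x} {y}) , Ψ-surjective)
  , λ c sr → level≡area-difference c (proj₁ sr) , level≡#adds c (proj₁ sr)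
  where open Bijection K p 0<p p<1 m n 1≤n rule
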